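{- For all integers $k\ge 3$, $r\geq 1$ and all reals $\mu\in(0, \frac{k-1}{k})$ there exist a dimension $n$ and a set of points $\mathcal{X}=\mathcal{X}(k,r,\mu)\subseteq [k]^n$ such that (i) for every $r$-colouring of $\mathcal{X}$ there is a monochromatic combinatorial line contained in $\mathcal{X}$, and (ii) every $\mathcal{Y}\subseteq \mathcal{X}$ contains a subset $\mathcal{Z}\subseteq \mathcal{Y}$ of size $|\mathcal{Z}|\geq \mu |\mathcal{Y}|$ such that $\mathcal{Z}$ contains no quasiline.
   Context: $[k]=\{1,\dots,k\}$ and $[k]^n$ is the $n$-dimensional Hales–Jewett cube. A combinatorial line in $[k]^n$ is the image of a map $\eta\colon[k]\to[k]^n$ for which there is a partition $[n]=C\cup M$ with $M\neq\emptyset$ such that, writing $\eta(i)=(u_{i1},\dots,u_{in})$, we have $u_{1c}=\dots=u_{kc}$ for all $c\in C$ and $u_{im}=i$ for all $i\in[k]$, $m\in M$. A quasiline in $[k]^n$ is a $k$-element subset $L\subseteq[k]^n$ such that for every coordinate $\nu\in[n]$ the $\nu$-th entries of the points of $L$ are either all identical or mutually distinct. -}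

module Defs where

open import Data.Nat using (ℕ; _≤_; _*_)
open import Data.Fin using (Fin)
open import Data.Bool using (Bool; true; false)
open import Data.Vec using (Vec; lookup)
open import Data.List using (List; length)
open import Data.List.Membership.Propositional using (_∈_)
open import Data.List.Relation.Unary.All using (All)
open import Data.List.Relation.Unary.Unique.Propositional using (Unique)
open import Data.Product using (Σ; ∃; _×_)
open import Data.Sum using (_⊎_)
open import Relation.Binary.PropositionalEquality using (_≡_)
open import Relation.Nullary using (¬_)

Point : ℕ → ℕ → Set
Point k n = Vec (Fin k) n

FinSet : ℕ → ℕ → Set
FinSet k n = List (Point k n)

IsSet : ∀ {k n} → FinSet k n → Set
IsSet A = Unique A

_⊆ₛ_ : ∀ {k n} → FinSet k n → FinSet k n → Set
A ⊆ₛ B = All (_∈ B) A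

IsCombinatorialLine : ∀ {k n} → (Fin k → Point k n) → Set
IsCombinatorialLine {k} {n} η =
  Σ (Fin n → Bool) λ M →
      (∃ λ m → M m ≡ true)
    × (∀ c → M c ≡ false → ∀ i j → lookup (η i) c ≡ lookup (η j) c)
    × (∀ m → M m ≡ true → ∀ i → lookup (η i) m ≡ i)

-- A k-element subset L = {ℓ(1),…,ℓ(k)} (ℓ injective) is a quasiline if in every
-- coordinate the entries are all identical or mutually distinct.
IsQuasiline : ∀ {k n} → (Fin k → Point k n) → Set
IsQuasiline {k} {n} ℓ =
    (∀ i j → ℓ i ≡ ℓ j → i ≡ j)
  × (∀ (ν : Fin n) →
        (∀ i j → lookup (ℓ i) ν ≡ lookup (ℓ j) ν)
      ⊎ (∀ i j → lookup (ℓ i) ν ≡ lookup (ℓ j) ν → i ≡ j))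

QuasilineFree : ∀ {k n} → FinSet k n → Set
QuasilineFree {k} {n} Z =
  ¬ (Σ (Fin k → Point k n) λ ℓ → IsQuasiline ℓ × (∀ i → ℓ i ∈ Z))

RamseyForLines : ∀ {k n} → ℕ → FinSet k n → Set
RamseyForLines {k} {n} r X =
  ∀ (c : Point k n → Fin r) →
    Σ (Fin k → Point k n) λ η →
        IsCombinatorialLine η
      × (∀ i → η i ∈ X)
      × (∀ i j → c (η i) ≡ c (η j))

-- With μ = p / q: every Y ⊆ X has a quasiline-free Z ⊆ Y with |Z| ≥ μ |Y|.
DenseQuasilineFree : ∀ {k n} → ℕ → ℕ → FinSet k n → Set
DenseQuasilineFree {k} {n} p q X =
  ∀ (Y : FinSet k n) → IsSet Y → Y ⊆ₛ X →
    Σ (FinSet k n) λ Z →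
        IsSet Z × Z ⊆ₛ Y
      × (p * length Y ≤ q * length Z)
      × QuasilineFree Z

{-# OPTIONS --safe #-}

-- Let Sh be the k-uniform hypergraph whose vertices are the decreasing m-tuples of labels below N
-- and whose edges are the k consecutive windows of a decreasing (m + k - 1)-tuple.  For large N it
-- has no proper r-colouring.  Mark every label independently with probability 1 / R; the tuples
-- whose first marked entry is at a position not divisible by k contain no edge, because the
-- position drops by one from each window to the next, and a fixed tuple belongs to this random set
-- with probability close to (k - 1) / k if R and m are large.  By averaging, every set of points
-- with a map to Sh that sends quasilines to edges satisfies (ii).
--
-- Such a set of points is produced by a partite construction over the "types" [k]^n × V(Sh), whose
-- edges pair a combinatorial line with an edge of Sh.  Starting from disjoint lines, one for each
-- edge, the types p are treated one at a time: the Hales-Jewett theorem is applied to the alphabet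
-- of all points of type p, and a copy of the current picture is glued to each resulting line.
-- Since k ≥ 3, the types along every quasiline of the new picture still form an edge.
-- In the end some copy of the initial picture has a colouring that depends on the types only, and
-- the types themselves have the Ramsey property by the Hales-Jewett theorem in [k]^n and by that of Sh.
module Submission where

open import Defs
open import Data.Nat using (ℕ; zero; suc; _+_; _*_; _^_; _∸_; _≤_; _<_; s≤s; z≤n; _<?_; _≟_; NonZero)
open import Data.Nat.Properties
open import Data.Nat.Tactic.RingSolver using (solve-∀)
open import Data.Bool using (Bool; true; false; if_then_else_)
import Data.Bool.Properties as Bool
open import Data.Fin using (Fin; zero; suc; toℕ; fromℕ<; funToFin; finToFun; combine; remQuot; splitAt; punchOut; _↑ˡ_; _↑ʳ_)
open import Data.Fin.Properties using (injective⇒≤; finToFun-funToFin; any?; pigeonhole; punchOut-injective; combine-remQuot; splitAt⁻¹-↑ˡ; splitAt⁻¹-↑ʳ; toℕ<n; toℕ-fromℕ<)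
import Data.Fin.Properties as Fin
open import Data.Vec as Vec using (Vec; []; _∷_; lookup; _++_; concat)
import Data.Vec.Properties as Vecₚ
open import Data.Vec.Relation.Unary.All as VAll using ([]; _∷_)
import Data.Vec.Relation.Unary.All.Properties as VAllₚ
open import Data.Vec.Relation.Unary.Any as VAny using (here; there)
import Data.Vec.Relation.Unary.Any.Properties as VAnyₚ
open import Data.Maybe using (Maybe; just; nothing; fromMaybe)
open import Data.Maybe.Relation.Unary.All as MAll using (just; nothing)
open import Data.List as List using (List; []; _∷_; length; take; drop; map; filter; replicate; deduplicate; cartesianProduct; allFin)
open import Data.List.Properties using (length-take; length-drop; take-all; take-map; drop-map)
import Data.List.Properties as Listₚ
open import Data.List.Relation.Unary.Any as Any using (here; there)
open import Data.List.Relation.Unary.Any.Properties using (lookup-index)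
open import Data.List.Relation.Unary.All as All using ()
import Data.List.Relation.Unary.Unique.Propositional.Properties as Uniqueₚ
open import Data.List.Relation.Unary.Unique.DecPropositional.Properties using (deduplicate-!)
open import Data.List.Membership.Propositional using (_∈_)
open import Data.List.Membership.Propositional.Properties using (∈-cartesianProductWith⁺; ∈-cartesianProductWith⁻; ∈-cartesianProduct⁺; ∈-cartesianProduct⁻; ∈-filter⁺; ∈-filter⁻; ∈-map⁺; ∈-map⁻; ∈-++⁺ˡ; ∈-++⁺ʳ; ∈-++⁻; ∈-allFin; ∈-lookup; ∈-deduplicate⁺; ∈-deduplicate⁻)
open import Data.Product using (Σ; ∃; _×_; _,_; proj₁; proj₂)
open import Data.Product.Properties using (≡-dec)
open import Data.Sum using (_⊎_; inj₁; inj₂)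
open import Data.Unit using (⊤; tt)
open import Data.Empty using (⊥-elim)
open import Relation.Nullary using (¬_; yes; no; Dec; does; contradiction)
open import Relation.Nullary.Decidable using (_×-dec_; dec-true; dec-false)
open import Relation.Binary using (DecidableEquality)
open import Relation.Binary.PropositionalEquality using (_≡_; _≢_; refl; sym; trans; cong; cong₂; subst; module ≡-Reasoning)
open import Function using (_∘_)

-- The Hales-Jewett theorem

allVecs : ∀ {A : Set} → List A → (n : ℕ) → List (Vec A n)
allVecs as zero = [] ∷ []
allVecs as (suc n) = List.cartesianProductWith _∷_ as (allVecs as n)

∈-allVecs⁺ : ∀ {A : Set} {as : List A} {n} {v : Vec A n} → VAll.All (_∈ as) v → v ∈ allVecs as n
∈-allVecs⁺ [] = here refl
∈-allVecs⁺ (a ∷ v) = ∈-cartesianProductWith⁺ _∷_ a (∈-allVecs⁺ v)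

∈-allVecs⁻ : ∀ {A : Set} (as : List A) {n} (v : Vec A n) → v ∈ allVecs as n → VAll.All (_∈ as) v
∈-allVecs⁻ as [] _ = []
∈-allVecs⁻ as (a ∷ v) p with ∈-cartesianProductWith⁻ _∷_ as (allVecs as _) p
... | _ , _ , a∈ , v∈ , refl = a∈ ∷ ∈-allVecs⁻ as v v∈

-- Packs a whole colouring of `bs` into one colour, so that a line monochromatic for the table is
-- monochromatic for every entry at once.
tableColour : ∀ {B : Set} {r} (bs : List B) → (B → Fin r) → Fin (r ^ length bs)
tableColour bs f = funToFin (λ i → f (List.lookup bs i))

tableColour-≡ : ∀ {B : Set} {r} (bs : List B) (f g : B → Fin r) → tableColour bs f ≡ tableColour bs g →
  ∀ {b} → b ∈ bs → f b ≡ g b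
tableColour-≡ bs f g eq {b} b∈ = begin
  f b                                           ≡⟨ cong f (lookup-index b∈) ⟩
  f (List.lookup bs i)                          ≡⟨ finToFun-funToFin (λ i → f (List.lookup bs i)) i ⟨
  finToFun (tableColour bs f) i                 ≡⟨ cong (λ c → finToFun c i) eq ⟩
  finToFun (tableColour bs g) i                 ≡⟨ finToFun-funToFin (λ i → g (List.lookup bs i)) i ⟩
  g (List.lookup bs i)                          ≡⟨ cong g (lookup-index b∈) ⟨
  g b                                           ∎
  where
  open ≡-Reasoning
  i = Any.index b∈

-- In a variable word, `nothing` is the variable.
VarWord : Set → ℕ → Set
VarWord A h = Vec (Maybe A) h

subst-var : ∀ {A : Set} {h} → A → VarWord A h → Vec A h
subst-var a = Vec.map (fromMaybe a)

HasVar : ∀ {A : Set} {h} → VarWord A h → Set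
HasVar = VAny.Any (_≡ nothing)

LettersIn : ∀ {A : Set} {h} → List A → VarWord A h → Set
LettersIn as = VAll.All (MAll.All (_∈ as))

subst-var-∈ : ∀ {A : Set} {as : List A} {h} {w : VarWord A h} {a} → a ∈ as → LettersIn as w →
  VAll.All (_∈ as) (subst-var a w)
subst-var-∈ a∈ [] = []
subst-var-∈ a∈ (just b∈ ∷ ps) = b∈ ∷ subst-var-∈ a∈ ps
subst-var-∈ a∈ (nothing ∷ ps) = a∈ ∷ subst-var-∈ a∈ ps

hasVar? : ∀ {A : Set} {h} (w : VarWord A h) → Dec (HasVar w)
hasVar? = VAny.any? λ { nothing → yes refl ; (just _) → no λ () }

varWords : ∀ {A : Set} → List A → (h : ℕ) → List (VarWord A h)
varWords as h = List.filter hasVar? (allVecs (nothing ∷ List.map just as) h)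

∈-varWords⁺ : ∀ {A : Set} {as : List A} {h} {w : VarWord A h} → HasVar w → LettersIn as w → w ∈ varWords as h
∈-varWords⁺ {as = as} v ls = ∈-filter⁺ hasVar? (∈-allVecs⁺ (VAll.map letter ls)) v
  where
  letter : ∀ {x} → MAll.All (_∈ as) x → x ∈ nothing ∷ List.map just as
  letter (just b∈) = there (∈-map⁺ just b∈)
  letter nothing = here refl

∈-varWords⁻ : ∀ {A : Set} {as : List A} {h} {w : VarWord A h} → w ∈ varWords as h → HasVar w × LettersIn as w
∈-varWords⁻ {as = as} {h} {w} w∈ with ∈-filter⁻ hasVar? {xs = allVecs (nothing ∷ List.map just as) h} w∈
... | w∈′ , v = v , VAll.map letter (∈-allVecs⁻ _ w w∈′)
  where
  letter : ∀ {x} → x ∈ nothing ∷ List.map just as → MAll.All (_∈ as) x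
  letter (here refl) = nothing
  letter (there x∈) with ∈-map⁻ just x∈
  ... | _ , b∈ , refl = just b∈

constWord : ∀ {A : Set} {h} → Vec A h → VarWord A h
constWord = Vec.map just

subst-constWord : ∀ {A : Set} {h} (a : A) (u : Vec A h) → subst-var a (constWord u) ≡ u
subst-constWord a u = trans (sym (Vecₚ.map-∘ (fromMaybe a) just u)) (Vecₚ.map-id u)

constWord-letters : ∀ {A : Set} {as : List A} {h} {u : Vec A h} → VAll.All (_∈ as) u → LettersIn as (constWord u)
constWord-letters [] = []
constWord-letters (p ∷ ps) = just p ∷ constWord-letters ps

module _ {A : Set} (as : List A) where

  -- Two alphabets are kept apart: fixed letters come from `as`, substituted letters from `xs`. The
  -- induction enlarges `xs` while `as` stays the same.
  MonoLine : ∀ {h r} → List A → (Vec A h → Fin r) → Set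
  MonoLine {h} xs c = Σ (VarWord A h) λ w → HasVar w × LettersIn as w ×
    (∀ {a b} → a ∈ xs → b ∈ xs → c (subst-var a w) ≡ c (subst-var b w))

  HalesJewett : List A → ℕ → Set
  HalesJewett xs r = Σ ℕ λ h → (c : Vec A h → Fin r) → MonoLine xs c

  -- The configuration of colour focusing. As soon as the focus has the colour of one of the lines,
  -- that line is monochromatic on `x ∷ xs` as well.
  record Focused {h r} (x : A) (xs : List A) (s : ℕ) (c : Vec A h → Fin r) : Set where
    field
      focus      : Vec A h
      focus∈     : VAll.All (_∈ as) focus
      colour     : Fin s → Fin r
      colour-inj : ∀ {i j} → colour i ≡ colour j → i ≡ j
      line       : Fin s → VarWord A h
      hasVar     : ∀ i → HasVar (line i)
      letters    : ∀ i → LettersIn as (line i)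
      at-x       : ∀ i → subst-var x (line i) ≡ focus
      at-xs      : ∀ i {a} → a ∈ xs → c (subst-var a (line i)) ≡ colour i

  Focusing : A → List A → ℕ → ℕ → Set
  Focusing x xs r s = Σ ℕ λ h → (c : Vec A h → Fin r) → MonoLine (x ∷ xs) c ⊎ Focused x xs s c

  focusing-zero : ∀ x xs r → Focusing x xs r 0
  focusing-zero x xs r = 0 , λ c → inj₂ record
    { focus = [] ; focus∈ = [] ; colour = λ () ; colour-inj = λ { {()} } ; line = λ ()
    ; hasVar = λ () ; letters = λ () ; at-x = λ () ; at-xs = λ () }

  module _ {x : A} {xs : List A} {r s : ℕ} (x∈as : x ∈ as) (xs⊆as : ∀ {a} → a ∈ xs → a ∈ as)
           {a₀ : A} (a₀∈ : a₀ ∈ xs) (hj : ∀ r → HalesJewett xs r) (F : Focusing x xs r s) where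

    private
      n₁ = proj₁ F
      us = allVecs as n₁
      n₂ = proj₁ (hj (r ^ length us))

    -- The second factor is coloured by tables over all `as`-words of the first. A line `v` found
    -- there lets any letter of `xs` be put into `v` without changing the colour, and the induction
    -- hypothesis is applied to the first factor with `v` frozen at `a₀`.
    focusing-step : (c : Vec A (n₁ + n₂) → Fin r) → MonoLine (x ∷ xs) c ⊎ Focused x xs (suc s) c
    focusing-step c with proj₂ (hj (r ^ length us)) (λ v → tableColour us (λ u → c (u ++ v)))
    ... | v , v-var , v-let , v-mono = result (proj₂ F c₁)
      where
      c₁ : Vec A n₁ → Fin r
      c₁ u = c (u ++ subst-var a₀ v)

      indep : ∀ {u a} → VAll.All (_∈ as) u → a ∈ xs → c (u ++ subst-var a v) ≡ c₁ u
      indep {u} {a} u∈ a∈ = tableColour-≡ us (λ u → c (u ++ subst-var a v)) c₁ (v-mono a∈ a₀∈) (∈-allVecs⁺ u∈)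

      v₀∈ : VAll.All (_∈ as) (subst-var a₀ v)
      v₀∈ = subst-var-∈ (xs⊆as a₀∈) v-let

      fixed : ∀ a (w : VarWord A n₁) → c (subst-var a (w ++ constWord (subst-var a₀ v))) ≡ c₁ (subst-var a w)
      fixed a w = cong c (trans (Vecₚ.map-++ (fromMaybe a) w _) (cong (subst-var a w ++_) (subst-constWord a _)))

      extend : (w : VarWord A n₁) → HasVar w → LettersIn as w →
        (∀ {a b} → a ∈ x ∷ xs → b ∈ x ∷ xs → c₁ (subst-var a w) ≡ c₁ (subst-var b w)) → MonoLine (x ∷ xs) c
      extend w w-var w-let w-mono =
        w ++ constWord (subst-var a₀ v) , VAnyₚ.++⁺ˡ w-var , VAllₚ.++⁺ w-let (constWord-letters v₀∈) ,
        λ {a} {b} a∈ b∈ → trans (fixed a w) (trans (w-mono a∈ b∈) (sym (fixed b w)))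

      result : MonoLine (x ∷ xs) c₁ ⊎ Focused x xs s c₁ → MonoLine (x ∷ xs) c ⊎ Focused x xs (suc s) c
      result (inj₁ (w , w-var , w-let , w-mono)) = inj₁ (extend w w-var w-let w-mono)
      -- Either the colour of the focus repeats and completes a line, or it is the colour of one
      -- further focused line.
      result (inj₂ foc) with any? (λ i → Focused.colour foc i Fin.≟ c₁ (Focused.focus foc))
      ... | yes (i , eq) = inj₁ (extend (line i) (hasVar i) (letters i) λ a∈ b∈ → trans (to-focus a∈) (sym (to-focus b∈)))
        where
        open Focused foc
        to-focus : ∀ {a} → a ∈ x ∷ xs → c₁ (subst-var a (line i)) ≡ c₁ focus
        to-focus (here refl) = cong c₁ (at-x i)
        to-focus (there a∈) = trans (at-xs i a∈) eq
      ... | no new = inj₂ record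
        { focus = focus ++ subst-var x v
        ; focus∈ = VAllₚ.++⁺ focus∈ (subst-var-∈ x∈as v-let)
        ; colour = colour′
        ; colour-inj = λ {i} {j} → colour′-inj i j
        ; line = line′
        ; hasVar = λ { zero → VAnyₚ.++⁺ʳ (constWord focus) v-var ; (suc i) → VAnyₚ.++⁺ˡ (hasVar i) }
        ; letters = λ { zero → VAllₚ.++⁺ (constWord-letters focus∈) v-let ; (suc i) → VAllₚ.++⁺ (letters i) v-let }
        ; at-x = λ { zero → at-zero x ; (suc i) → trans (at-suc x i) (cong (_++ subst-var x v) (at-x i)) }
        ; at-xs = λ { zero {a} a∈ → trans (cong c (at-zero a)) (indep focus∈ a∈)
                    ; (suc i) {a} a∈ → trans (cong c (at-suc a i))
                        (trans (indep (subst-var-∈ (xs⊆as a∈) (letters i)) a∈) (at-xs i a∈)) }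
        }
        where
        open Focused foc
        colour′ : Fin (suc s) → Fin r
        colour′ zero = c₁ focus
        colour′ (suc i) = colour i
        colour′-inj : ∀ i j → colour′ i ≡ colour′ j → i ≡ j
        colour′-inj zero zero _ = refl
        colour′-inj zero (suc j) eq = ⊥-elim (new (j , sym eq))
        colour′-inj (suc i) zero eq = ⊥-elim (new (i , eq))
        colour′-inj (suc i) (suc j) eq = cong suc (colour-inj eq)
        line′ : Fin (suc s) → VarWord A (n₁ + n₂)
        -- The new line rests at the old focus and moves along `v` only; the old lines move along
        -- `v` simultaneously, so that all meet at `focus ++ subst-var x v`.
        line′ zero = constWord focus ++ v
        line′ (suc i) = line i ++ v
        at-zero : ∀ a → subst-var a (line′ zero) ≡ focus ++ subst-var a v
        at-zero a = trans (Vecₚ.map-++ (fromMaybe a) (constWord focus) v) (cong (_++ subst-var a v) (subst-constWord a focus))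
        at-suc : ∀ a i → subst-var a (line′ (suc i)) ≡ subst-var a (line i) ++ subst-var a v
        at-suc a i = Vecₚ.map-++ (fromMaybe a) (line i) v

  focusing : ∀ {x xs r} → x ∈ as → (∀ {a} → a ∈ xs → a ∈ as) → ∀ {a₀} → a₀ ∈ xs →
    (∀ r → HalesJewett xs r) → ∀ s → Focusing x xs r s
  focusing x∈ xs⊆ a₀∈ hj zero = focusing-zero _ _ _
  focusing x∈ xs⊆ a₀∈ hj (suc s) = _ , focusing-step x∈ xs⊆ a₀∈ hj (focusing x∈ xs⊆ a₀∈ hj s)

  -- Focusing `suc r` lines would require `suc r` distinct colours, so the focusing must end with a
  -- monochromatic line.
  hales-jewett-∷ : ∀ {x xs} → x ∈ as → (∀ {a} → a ∈ xs → a ∈ as) → ∀ {a₀} → a₀ ∈ xs →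
    (∀ r → HalesJewett xs r) → ∀ r → HalesJewett (x ∷ xs) r
  hales-jewett-∷ {x} {xs} x∈ xs⊆ a₀∈ hj r = proj₁ F , λ c → finish (proj₂ F c)
    where
    F : Focusing x xs r (suc r)
    F = focusing x∈ xs⊆ a₀∈ hj (suc r)
    finish : ∀ {c : Vec A (proj₁ F) → Fin r} → MonoLine (x ∷ xs) c ⊎ Focused x xs (suc r) c → MonoLine (x ∷ xs) c
    finish (inj₁ m) = m
    finish (inj₂ foc) = ⊥-elim (1+n≰n (injective⇒≤ (Focused.colour-inj foc)))

  hales-jewett : ∀ xs → (∀ {a} → a ∈ xs → a ∈ as) → ∀ r → HalesJewett xs r
  hales-jewett [] _ r = 1 , λ c → (nothing ∷ []) , here refl , (nothing ∷ []) , λ ()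
  hales-jewett (x ∷ []) _ r = 1 , λ c → (nothing ∷ []) , here refl , (nothing ∷ []) , λ { (here refl) (here refl) → refl }
  hales-jewett (x ∷ y ∷ ys) xs⊆ r =
    hales-jewett-∷ (xs⊆ (here refl)) (xs⊆ ∘ there) (here refl) (hales-jewett (y ∷ ys) (xs⊆ ∘ there)) r

-- The partite construction

injective⇒surjective : ∀ {n} {f : Fin n → Fin n} → (∀ i j → f i ≡ f j → i ≡ j) → ∀ y → ∃ λ x → f x ≡ y
injective⇒surjective {suc n} {f} inj y with any? (λ x → f x Fin.≟ y)
... | yes found = found
... | no missed = ⊥-elim (1+n≰n (injective⇒≤ {f = λ x → punchOut (y≢f x)}
                    (λ eq → inj _ _ (punchOut-injective (y≢f _) (y≢f _) eq))))
  where
  y≢f : ∀ x → y ≢ f x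
  y≢f x eq = missed (x , sym eq)

∀⊎∃ : ∀ {h} {A B : Fin h → Set} → (∀ ν → A ν ⊎ B ν) → (∀ ν → A ν) ⊎ (∃ λ ν → B ν)
∀⊎∃ {zero} f = inj₁ λ ()
∀⊎∃ {suc h} f with f zero | ∀⊎∃ (f ∘ suc)
... | inj₂ b | _ = inj₂ (zero , b)
... | inj₁ a | inj₂ (ν , b) = inj₂ (suc ν , b)
... | inj₁ a | inj₁ as = inj₁ λ { zero → a ; (suc ν) → as ν }

-- Weak quasilines and weak lines

Constant : ∀ {k} {A : Set} → (Fin k → A) → Set
Constant f = ∀ i j → f i ≡ f j

Distinct : ∀ {k} {A : Set} → (Fin k → A) → Set
Distinct f = ∀ i j → f i ≡ f j → i ≡ j

-- Injectivity is dropped here, and a moving coordinate in `WeakLine`, so that both notions pass to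
-- blocks of coordinates, on which the points may coincide.
WeakQuasiline : ∀ {k n} → (Fin k → Point k n) → Set
WeakQuasiline ℓ = ∀ ν → Constant (λ i → lookup (ℓ i) ν) ⊎ Distinct (λ i → lookup (ℓ i) ν)

WeakLine : ∀ {k n} → (Fin k → Point k n) → Set
WeakLine η = ∀ ν → Constant (λ i → lookup (η i) ν) ⊎ (∀ i → lookup (η i) ν ≡ i)

lookup-ext : ∀ {A : Set} {n} {u v : Vec A n} → (∀ ν → lookup u ν ≡ lookup v ν) → u ≡ v
lookup-ext {u = []} {[]} _ = refl
lookup-ext {u = x ∷ u} {y ∷ v} eq = cong₂ _∷_ (eq zero) (lookup-ext (eq ∘ suc))

module _ {k : ℕ} where

  Constant-resp : ∀ {A : Set} {f g : Fin k → A} → (∀ i → f i ≡ g i) → Constant f → Constant g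
  Constant-resp eq c i j = trans (sym (eq i)) (trans (c i j) (eq j))

  Distinct-resp : ∀ {A : Set} {f g : Fin k → A} → (∀ i → f i ≡ g i) → Distinct f → Distinct g
  Distinct-resp eq d i j e = d i j (trans (eq i) (trans e (sym (eq j))))

  CD-resp : ∀ {A : Set} {f g : Fin k → A} → (∀ i → f i ≡ g i) → Constant f ⊎ Distinct f → Constant g ⊎ Distinct g
  CD-resp eq (inj₁ c) = inj₁ (Constant-resp eq c)
  CD-resp eq (inj₂ d) = inj₂ (Distinct-resp eq d)

  weakQuasiline-++ˡ : ∀ {m n} {u : Fin k → Point k m} {v : Fin k → Point k n} →
    WeakQuasiline (λ i → u i ++ v i) → WeakQuasiline u
  weakQuasiline-++ˡ {u = u} {v} wq ν = CD-resp (λ i → Vecₚ.lookup-++ˡ (u i) (v i) ν) (wq (ν ↑ˡ _))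

  weakQuasiline-++ʳ : ∀ {m n} {u : Fin k → Point k m} {v : Fin k → Point k n} →
    WeakQuasiline (λ i → u i ++ v i) → WeakQuasiline v
  weakQuasiline-++ʳ {u = u} {v} wq ν = CD-resp (λ i → Vecₚ.lookup-++ʳ (u i) (v i) ν) (wq (_ ↑ʳ ν))

  weakQuasiline-concat : ∀ {d h} {u : Fin k → Vec (Point k d) h} →
    WeakQuasiline (λ i → concat (u i)) → ∀ ν → WeakQuasiline (λ i → lookup (u i) ν)
  weakQuasiline-concat {u = u} wq ν μ = CD-resp (λ i → Vecₚ.lookup-concat (u i) ν μ) (wq (combine ν μ))

  WL-resp : ∀ {f g : Fin k → Fin k} → (∀ i → f i ≡ g i) → Constant f ⊎ (∀ i → f i ≡ i) → Constant g ⊎ (∀ i → g i ≡ i)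
  WL-resp eq (inj₁ c) = inj₁ (Constant-resp eq c)
  WL-resp eq (inj₂ d) = inj₂ λ i → trans (sym (eq i)) (d i)

  weakLine-++ : ∀ {m n} {u : Fin k → Point k m} {v : Fin k → Point k n} →
    WeakLine u → WeakLine v → WeakLine (λ i → u i ++ v i)
  weakLine-++ {m} {u = u} {v} lu lv ν with splitAt m ν in eq
  ... | inj₁ μ rewrite sym (splitAt⁻¹-↑ˡ eq) = WL-resp (λ i → sym (Vecₚ.lookup-++ˡ (u i) (v i) μ)) (lu μ)
  ... | inj₂ μ rewrite sym (splitAt⁻¹-↑ʳ eq) = WL-resp (λ i → sym (Vecₚ.lookup-++ʳ (u i) (v i) μ)) (lv μ)

  weakLine-concat : ∀ {d h} {u : Fin k → Vec (Point k d) h} → (∀ ν → WeakLine (λ i → lookup (u i) ν)) →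
    WeakLine (λ i → concat (u i))
  weakLine-concat {d} {h} {u} lu ν = subst (λ ν → Constant (λ i → lookup (concat (u i)) ν) ⊎ (∀ i → lookup (concat (u i)) ν ≡ i))
    (combine-remQuot {h} d ν)
    (WL-resp (λ i → sym (Vecₚ.lookup-concat (u i) ν₁ ν₂)) (lu ν₁ ν₂))
    where
    ν₁ = proj₁ (remQuot {h} d ν)
    ν₂ = proj₂ (remQuot {h} d ν)

  weakLine-subst : ∀ {d h} {η : Fin k → Point k d} (w : VarWord (Point k d) h) → WeakLine η →
    ∀ ν → WeakLine (λ i → lookup (subst-var (η i) w) ν)
  weakLine-subst (nothing ∷ w) l zero = l
  weakLine-subst (just b ∷ w) l zero μ = inj₁ λ _ _ → refl
  weakLine-subst (_ ∷ w) l (suc ν) = weakLine-subst w l ν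

  weakLine⇒quasi : ∀ {n} {η : Fin k → Point k n} → WeakLine η → ∀ ν → Constant (λ i → lookup (η i) ν) ⊎ Distinct (λ i → lookup (η i) ν)
  weakLine⇒quasi l ν with l ν
  ... | inj₁ c = inj₁ c
  ... | inj₂ e = inj₂ λ i j p → trans (sym (e i)) (trans p (e j))

  weakLine-varWord : ∀ {h} (w : VarWord (Fin k) h) → WeakLine (λ i → subst-var i w)
  weakLine-varWord (nothing ∷ w) zero = inj₂ λ _ → refl
  weakLine-varWord (just _ ∷ w) zero = inj₁ λ _ _ → refl
  weakLine-varWord (_ ∷ w) (suc ν) = weakLine-varWord w ν

  varWord-distinct : ∀ {h} {w : VarWord (Fin k) h} → HasVar w → Distinct (λ i → subst-var i w)
  varWord-distinct (here refl) i j eq = cong Vec.head eq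
  varWord-distinct {w = _ ∷ _} (there v) i j eq = varWord-distinct v i j (cong Vec.tail eq)

-- Two points already decide whether a coordinate is constant, and k − 1 points decide the last one.
module _ {k n : ℕ} {u v : Fin k → Point k n} {i₀ i₁ i₂ : Fin k} (i₁≢i₀ : i₁ ≢ i₀) (i₂≢i₀ : i₂ ≢ i₀) (i₁≢i₂ : i₁ ≢ i₂) where

  weakQuasiline-last : WeakQuasiline u → WeakQuasiline v → (∀ i → i ≢ i₀ → u i ≡ v i) → u i₀ ≡ v i₀
  weakQuasiline-last wu wv agree = lookup-ext coord
    where
    agree′ : ∀ ν i → i ≢ i₀ → lookup (u i) ν ≡ lookup (v i) ν
    agree′ ν i ne = cong (λ x → lookup x ν) (agree i ne)
    coord : ∀ ν → lookup (u i₀) ν ≡ lookup (v i₀) ν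
    coord ν with wu ν | wv ν
    ... | inj₁ cu | inj₁ cv = trans (cu i₀ i₁) (trans (agree′ ν i₁ i₁≢i₀) (cv i₁ i₀))
    ... | inj₁ cu | inj₂ dv = ⊥-elim (i₁≢i₂ (dv i₁ i₂ (trans (sym (agree′ ν i₁ i₁≢i₀)) (trans (cu i₁ i₂) (agree′ ν i₂ i₂≢i₀)))))
    ... | inj₂ du | inj₁ cv = ⊥-elim (i₁≢i₂ (du i₁ i₂ (trans (agree′ ν i₁ i₁≢i₀) (trans (cv i₁ i₂) (sym (agree′ ν i₂ i₂≢i₀))))))
    ... | inj₂ du | inj₂ dv with injective⇒surjective du (lookup (v i₀) ν)
    ...   | i , eq with i Fin.≟ i₀
    ...     | yes refl = eq
    ...     | no ne = ⊥-elim (ne (dv i i₀ (trans (sym (agree′ ν i ne)) eq)))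

module PartiteConstruction (k′ : ℕ) where

  k : ℕ
  k = 3 + k′

  others : (i : Fin k) → Σ (Fin k) λ i₁ → Σ (Fin k) λ i₂ → i₁ ≢ i × i₂ ≢ i × i₁ ≢ i₂
  others zero = suc zero , suc (suc zero) , (λ ()) , (λ ()) , λ ()
  others (suc zero) = zero , suc (suc zero) , (λ ()) , (λ ()) , λ ()
  others (suc (suc _)) = zero , suc zero , (λ ()) , (λ ()) , λ ()

  bitValue : Bool → Fin k
  bitValue true = suc zero
  bitValue false = zero

  -- Among three indices two share a bit, which excludes the distinct case.
  two-valued⇒constant : (f : Fin k → Bool) → Constant (bitValue ∘ f) ⊎ Distinct (bitValue ∘ f) → Constant f
  two-valued⇒constant f (inj₁ c) i j with f i | f j | c i j
  ... | true | true | _ = refl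
  ... | false | false | _ = refl
  ... | true | false | ()
  ... | false | true | ()
  two-valued⇒constant f (inj₂ d) with f zero | f (suc zero) | f (suc (suc zero)) | d zero (suc zero) | d zero (suc (suc zero)) | d (suc zero) (suc (suc zero))
  ... | true | true | _ | p | _ | _ with () ← p refl
  ... | false | false | _ | p | _ | _ with () ← p refl
  ... | true | false | true | _ | p | _ with () ← p refl
  ... | false | true | false | _ | p | _ with () ← p refl
  ... | true | false | false | _ | _ | p with () ← p refl
  ... | false | true | true | _ | _ | p with () ← p refl

  weakLine⇒combinatorialLine : ∀ {n} {η : Fin k → Point k n} → WeakLine η → Distinct η → IsCombinatorialLine η
  weakLine⇒combinatorialLine {n} {η} l inj = M , some (∀⊎∃ l) , const , moves
    where
    M : Fin n → Bool
    M ν with l ν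
    ... | inj₁ _ = false
    ... | inj₂ _ = true
    const : ∀ ν → M ν ≡ false → Constant (λ i → lookup (η i) ν)
    const ν eq with l ν
    const ν eq | inj₁ c = c
    const ν () | inj₂ _
    moves : ∀ ν → M ν ≡ true → ∀ i → lookup (η i) ν ≡ i
    moves ν eq with l ν
    moves ν () | inj₁ _
    moves ν eq | inj₂ e = e
    some : (∀ ν → Constant (λ i → lookup (η i) ν)) ⊎ (∃ λ ν → ∀ i → lookup (η i) ν ≡ i) → ∃ λ ν → M ν ≡ true
    some (inj₁ c) with () ← inj zero (suc zero) (lookup-ext λ ν → c ν zero (suc zero))
    some (inj₂ (ν , e)) = ν , move
      where
      move : M ν ≡ true
      move with l ν
      ... | inj₂ _ = refl
      ... | inj₁ c with () ← trans (sym (e zero)) (trans (c zero (suc zero)) (e (suc zero)))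

  module _ {n m : ℕ} {S : Set} (_≟S_ : DecidableEquality S)
           (base : Fin m → Fin k → Point k n) (win : Fin m → Fin k → S)
           (base-line : ∀ a → WeakLine (base a)) (base-inj : ∀ a → Distinct (base a)) where

    Type : Set
    Type = Point k n × S

    _≟T_ : DecidableEquality Type
    _≟T_ = ≡-dec (Vecₚ.≡-dec Fin._≟_) _≟S_

    typ : Fin m → Fin k → Type
    typ a i = base a i , win a i

    -- A quasiline carries no order, so its types are compared with those of `a` only up to the
    -- permutation `ρ`.
    Edge : (Fin k → Type) → Set
    Edge t = Σ (Fin m) λ a → Σ (Fin k → Fin k) λ ρ → Distinct ρ × (∀ i → t i ≡ typ a (ρ i))

    Edge-resp : ∀ {t u} → (∀ i → t i ≡ u i) → Edge t → Edge u
    Edge-resp eq (a , ρ , ρ-inj , e) = a , ρ , ρ-inj , λ i → trans (sym (eq i)) (e i)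

    -- The points of the line `base a` already separate the types, whatever the windows are.
    edge-distinct : ∀ {t} → Edge t → Distinct (proj₁ ∘ t)
    edge-distinct (a , ρ , ρ-inj , e) i j eq =
      ρ-inj i j (base-inj a _ _ (trans (sym (cong proj₁ (e i))) (trans eq (cong proj₁ (e j)))))

    edge-quasi : ∀ {t} → Edge t → WeakQuasiline (proj₁ ∘ t)
    edge-quasi (a , ρ , ρ-inj , e) ν = CD-resp (λ i → sym (cong (λ t → lookup (proj₁ t) ν) (e i))) col
      where
      col : Constant (λ i → lookup (base a (ρ i)) ν) ⊎ Distinct (λ i → lookup (base a (ρ i)) ν)
      col with weakLine⇒quasi {η = base a} (base-line a) ν
      ... | inj₁ c = inj₁ λ i j → c (ρ i) (ρ j)
      ... | inj₂ d = inj₂ λ i j eq → ρ-inj i j (d (ρ i) (ρ j) eq)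

    Picture : ℕ → Set
    Picture d = List (Type × Point k d)

    -- The invariant of the construction. The constant alternative covers degenerate families, which
    -- occur as blocks of quasilines in an amalgam.
    Coherent : ∀ {d} → Picture d → Set
    Coherent Π = (y : Fin k → Type × Point k _) → (∀ i → y i ∈ Π) → WeakQuasiline (proj₂ ∘ y) →
      Constant y ⊎ Edge (proj₁ ∘ y)

    -- t i ν is the type of block ν of the i-th point of a weak quasiline in an amalgam over the type p,
    -- and q i is the type of that point.
    module _ {h : ℕ} {p : Type} {q : Fin k → Type} {t : Fin k → Fin h → Type}
             (entry : ∀ i ν → t i ν ≡ p ⊎ t i ν ≡ q i) (hit : ∀ i → ∃ λ ν → t i ν ≡ q i) where

      -- If `q i` is `p`, every entry at `i` equals `q i`, and a column hit by `j` gives the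
      -- comparison. Otherwise a column hit by `i` cannot contain `p`, so its entry at `j` is `q j`.
      constant-columns : (∀ ν → Constant (λ i → t i ν)) → Constant q
      constant-columns cst i j with q i ≟T p
      ... | yes qi≡p with hit j
      ...   | ν , tj≡qj with entry i ν
      ...     | inj₁ ti≡p = trans qi≡p (trans (sym ti≡p) (trans (cst ν i j) tj≡qj))
      ...     | inj₂ ti≡qi = trans (sym ti≡qi) (trans (cst ν i j) tj≡qj)
      constant-columns cst i j | no qi≢p with hit i
      ... | ν , ti≡qi with entry j ν
      ...   | inj₁ tj≡p = ⊥-elim (qi≢p (trans (sym ti≡qi) (trans (cst ν i j) tj≡p)))
      ...   | inj₂ tj≡qj = trans (sym ti≡qi) (trans (cst ν i j) tj≡qj)

      -- An edge column differs from `q` in at most one place, because `p` occurs at most once in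
      -- it. In the bad case a second column, hit at that place, turns out to be `q` itself.
      edge-column : (∀ ν → Constant (λ i → t i ν) ⊎ Edge (λ i → t i ν)) → WeakQuasiline (proj₁ ∘ q) →
        ∀ ν → Edge (λ i → t i ν) → Edge q
      edge-column cols wq ν e with any? (λ i → t i ν ≟T p)
      ... | no none = Edge-resp (λ i → fix i (entry i ν)) e
        where
        fix : ∀ i → t i ν ≡ p ⊎ t i ν ≡ q i → t i ν ≡ q i
        fix i (inj₁ eq) = ⊥-elim (none (i , eq))
        fix i (inj₂ eq) = eq
      ... | yes (i₀ , ti₀≡p) with q i₀ ≟T p
      ...   | yes qi₀≡p = Edge-resp (λ i → fix i (entry i ν)) e
        where
        fix : ∀ i → t i ν ≡ p ⊎ t i ν ≡ q i → t i ν ≡ q i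
        fix i (inj₁ eq) with edge-distinct e i i₀ (cong proj₁ (trans eq (sym ti₀≡p)))
        ... | refl = trans ti₀≡p (sym qi₀≡p)
        fix i (inj₂ eq) = eq
      ...   | no qi₀≢p = second (proj₁ (hit i₀)) (proj₂ (hit i₀))
        where
        off : ∀ i → i ≢ i₀ → t i ν ≡ q i
        off i ne with entry i ν
        ... | inj₁ eq = ⊥-elim (ne (edge-distinct e i i₀ (cong proj₁ (trans eq (sym ti₀≡p)))))
        ... | inj₂ eq = eq
        second : ∀ ν′ → t i₀ ν′ ≡ q i₀ → Edge q
        second ν′ eq₀ with others i₀
        ... | i₁ , i₂ , i₁≢i₀ , i₂≢i₀ , i₁≢i₂ with cols ν′
        -- A constant second column makes all `q i` equal, as its value `q i₀` is not `p`. But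
        -- column `ν` agrees with `q` at `i₁` and `i₂`, where its types differ.
        ...   | inj₁ c = ⊥-elim (i₁≢i₂ (edge-distinct e i₁ i₂
                  (cong proj₁ (trans (off i₁ i₁≢i₀) (trans (to-q₀ i₁) (trans (sym (to-q₀ i₂)) (sym (off i₂ i₂≢i₀))))))))
          where
          to-q₀ : ∀ i → q i ≡ q i₀
          to-q₀ i with entry i ν′
          ... | inj₁ eq = ⊥-elim (qi₀≢p (trans (sym eq₀) (trans (c i₀ i) eq)))
          ... | inj₂ eq = trans (sym eq) (trans (c i i₀) eq₀)
        ...   | inj₂ e′ = Edge-resp (λ i → fix i (entry i ν′)) e′
          where
          -- This is what the prefix proj₁ q of an amalgamated point is for: without it the
          -- blocks (p , a , b …) and (a , p , b …) could combine to points of types (a , a , b …).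
          prefix : proj₁ (q i₀) ≡ proj₁ p
          prefix = trans (weakQuasiline-last i₁≢i₀ i₂≢i₀ i₁≢i₂ wq (edge-quasi e) (λ i ne → sym (cong proj₁ (off i ne))))
                         (cong proj₁ ti₀≡p)
          -- An entry `p` at `i` has the same cube point as the entry `q i₀` at `i₀`, so
          -- distinctness along the edge gives `i = i₀`.
          fix : ∀ i → t i ν′ ≡ p ⊎ t i ν′ ≡ q i → t i ν′ ≡ q i
          fix i (inj₂ eq) = eq
          fix i (inj₁ eq) with edge-distinct e′ i i₀ (trans (cong proj₁ eq) (trans (sym prefix) (sym (cong proj₁ eq₀))))
          ... | refl = eq₀

    -- Amalgamation over one type

    module _ {d : ℕ} (Π : Picture d) (p : Type) where

      part : List (Point k d)
      part = List.map proj₂ (List.filter (λ y → proj₁ y ≟T p) Π)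

      ∈-part⁺ : ∀ {x} → (p , x) ∈ Π → x ∈ part
      ∈-part⁺ x∈ = ∈-map⁺ proj₂ (∈-filter⁺ (λ y → proj₁ y ≟T p) x∈ refl)

      ∈-part⁻ : ∀ {x} → x ∈ part → (p , x) ∈ Π
      ∈-part⁻ x∈ with ∈-map⁻ proj₂ x∈
      ... | (q , x) , y∈ , refl with ∈-filter⁻ (λ y → proj₁ y ≟T p) {xs = Π} y∈
      ...   | y∈Π , refl = y∈Π

      embed : ∀ {h} → VarWord (Point k d) h → Type × Point k d → Type × Point k (n + h * d)
      embed w (q , x) = q , proj₁ q ++ concat (subst-var x w)

      -- Every line of the cube over the alphabet `part` carries a copy of `Π`. Points of type `p`
      -- become words over `part`, which several copies may share.
      amalgam : (h : ℕ) → Picture (n + h * d)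
      amalgam h = List.cartesianProductWith embed (varWords part h) Π

      blockType : ∀ {h} → VarWord (Point k d) h → Type → Fin h → Type
      blockType w q ν with lookup w ν
      ... | nothing = q
      ... | just _ = p

      block-∈ : ∀ {h} (w : VarWord (Point k d) h) {q x} → LettersIn part w → (q , x) ∈ Π →
        ∀ ν → (blockType w q ν , lookup (subst-var x w) ν) ∈ Π
      block-∈ (nothing ∷ w) (_ ∷ ls) y∈ zero = y∈
      block-∈ (just b ∷ w) (just b∈ ∷ ls) y∈ zero = ∈-part⁻ b∈
      block-∈ (_ ∷ w) (_ ∷ ls) y∈ (suc ν) = block-∈ w ls y∈ ν

      blockType-entry : ∀ {h} (w : VarWord (Point k d) h) q ν → blockType w q ν ≡ p ⊎ blockType w q ν ≡ q
      blockType-entry w q ν with lookup w ν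
      ... | nothing = inj₂ refl
      ... | just _ = inj₁ refl

      blockType-hit : ∀ {h} {w : VarWord (Point k d) h} q → HasVar w → ∃ λ ν → blockType w q ν ≡ q
      blockType-hit q (here refl) = zero , refl
      blockType-hit q (there v) with blockType-hit q v
      ... | ν , eq = suc ν , eq

      -- Coherence of `Π` applies to each block separately. If all blocks are constant the points
      -- coincide; otherwise some block is an edge, and `edge-column` passes from it to the types of
      -- the points.
      amalgam-coherent : Coherent Π → ∀ h → Coherent (amalgam h)
      amalgam-coherent coh h y y∈ wq = conclude (∀⊎∃ cols)
        where
        source : ∀ i → Σ (VarWord (Point k d) h) λ w → Σ (Type × Point k d) λ x → w ∈ varWords part h × x ∈ Π × y i ≡ embed w x
        source i with ∈-cartesianProductWith⁻ embed (varWords part h) Π (y∈ i)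
        ... | w , x , w∈ , x∈ , eq = w , x , w∈ , x∈ , eq
        w : Fin k → VarWord (Point k d) h
        w i = proj₁ (source i)
        q : Fin k → Type
        q i = proj₁ (proj₁ (proj₂ (source i)))
        x : Fin k → Point k d
        x i = proj₂ (proj₁ (proj₂ (source i)))
        x∈ : ∀ i → (q i , x i) ∈ Π
        x∈ i = proj₁ (proj₂ (proj₂ (proj₂ (source i))))
        wv : ∀ i → HasVar (w i) × LettersIn part (w i)
        wv i = ∈-varWords⁻ (proj₁ (proj₂ (proj₂ (source i))))
        y≡ : ∀ i → y i ≡ embed (w i) (q i , x i)
        y≡ i = proj₂ (proj₂ (proj₂ (proj₂ (source i))))
        wq′ : WeakQuasiline (λ i → proj₁ (q i) ++ concat (subst-var (x i) (w i)))
        wq′ ν = CD-resp (λ i → cong (λ z → lookup (proj₂ z) ν) (y≡ i)) (wq ν)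
        block : Fin h → Fin k → Type × Point k d
        block ν i = blockType (w i) (q i) ν , lookup (subst-var (x i) (w i)) ν
        cols : ∀ ν → Constant (block ν) ⊎ Edge (proj₁ ∘ block ν)
        cols ν = coh (block ν) (λ i → block-∈ (w i) (proj₂ (wv i)) (x∈ i) ν)
          (weakQuasiline-concat {u = λ i → subst-var (x i) (w i)}
            (weakQuasiline-++ʳ {u = λ i → proj₁ (q i)} wq′) ν)
        entry : ∀ i ν → blockType (w i) (q i) ν ≡ p ⊎ blockType (w i) (q i) ν ≡ q i
        entry i ν = blockType-entry (w i) (q i) ν
        hit : ∀ i → ∃ λ ν → blockType (w i) (q i) ν ≡ q i
        hit i = blockType-hit (q i) (proj₁ (wv i))
        conclude : (∀ ν → Constant (block ν)) ⊎ (∃ λ ν → Edge (proj₁ ∘ block ν)) → Constant y ⊎ Edge (proj₁ ∘ y)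
        conclude (inj₁ cst) = inj₁ (Constant-resp (sym ∘ y≡) λ i j →
          cong₂ (λ q v → q , proj₁ q ++ concat v)
            (constant-columns entry hit (λ ν i j → cong proj₁ (cst ν i j)) i j)
            (lookup-ext {u = subst-var (x i) (w i)} {subst-var (x j) (w j)} λ ν → cong proj₂ (cst ν i j)))
        conclude (inj₂ (ν , e)) = inj₂ (Edge-resp (λ i → sym (cong proj₁ (y≡ i)))
          (edge-column entry hit cols′ (weakQuasiline-++ˡ {u = λ i → proj₁ (q i)} {λ i → concat (subst-var (x i) (w i))} wq′) ν e))
          where
          cols′ : ∀ ν → Constant (proj₁ ∘ block ν) ⊎ Edge (proj₁ ∘ block ν)
          cols′ ν with cols ν
          ... | inj₁ c = inj₁ λ i j → cong proj₁ (c i j)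
          ... | inj₂ e = inj₂ e

    -- The initial picture of disjoint lines

    point₀ : Fin m → Fin k → Point k (suc m)
    point₀ a i = i ∷ Vec.tabulate (λ b → bitValue (does (a Fin.≟ b)))

    picture₀ : Picture (suc m)
    picture₀ = List.cartesianProductWith (λ a i → typ a i , point₀ a i) (List.allFin m) (List.allFin k)

    -- The coordinates after the first are the indicator vector of the line. Being two-valued they
    -- must be constant, so all points lie on one line, and the first coordinate separates a
    -- repeated point from an edge.
    picture₀-coherent : Coherent picture₀
    picture₀-coherent y y∈ wq = conclude (wq′ zero)
      where
      source : ∀ i → Σ (Fin m) λ a → Σ (Fin k) λ j → y i ≡ (typ a j , point₀ a j)
      source i with ∈-cartesianProductWith⁻ _ (List.allFin m) (List.allFin k) (y∈ i)
      ... | a , j , _ , _ , eq = a , j , eq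
      a : Fin k → Fin m
      a i = proj₁ (source i)
      ρ : Fin k → Fin k
      ρ i = proj₁ (proj₂ (source i))
      y≡ : ∀ i → y i ≡ (typ (a i) (ρ i) , point₀ (a i) (ρ i))
      y≡ i = proj₂ (proj₂ (source i))
      wq′ : WeakQuasiline (λ i → point₀ (a i) (ρ i))
      wq′ ν = CD-resp (λ i → cong (λ z → lookup (proj₂ z) ν) (y≡ i)) (wq ν)
      a≡ : ∀ i → a i ≡ a zero
      a≡ i with a i Fin.≟ a zero | two-valued⇒constant (λ j → does (a j Fin.≟ a zero))
        (CD-resp (λ j → Vecₚ.lookup∘tabulate _ (a zero)) (wq′ (suc (a zero)))) i zero
      ... | yes eq | _ = eq
      ... | no _ | eq with () ← trans eq (dec-true (a zero Fin.≟ a zero) refl)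
      conclude : Constant ρ ⊎ Distinct ρ → Constant y ⊎ Edge (proj₁ ∘ y)
      conclude (inj₁ c) = inj₁ (Constant-resp (sym ∘ y≡) λ i j →
        cong₂ (λ a i → typ a i , point₀ a i) (trans (a≡ i) (sym (a≡ j))) (c i j))
      conclude (inj₂ dst) = inj₂ (a zero , ρ , dst , λ i →
        trans (cong proj₁ (y≡ i)) (cong (λ b → typ b (ρ i)) (a≡ i)))

    point₀-line : ∀ a → WeakLine (point₀ a)
    point₀-line a zero = inj₂ λ _ → refl
    point₀-line a (suc ν) = inj₁ λ _ _ → refl

    -- Copies coloured according to their types

    module _ (r : ℕ) (colour₀ : Fin r) where

      -- A copy of the initial system of lines inside `Π`. The list `ps` holds the types treated so
      -- far; only on these does the colour depend on the type alone.
      record Copy {d} (Π : Picture d) (ps : List Type) (c : Type × Point k d → Fin r) : Set where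
        field
          φ      : Fin m → Fin k → Point k d
          colour : Type → Fin r
          φ∈     : ∀ a i → (typ a i , φ a i) ∈ Π
          line   : ∀ a → WeakLine (φ a)
          inj    : ∀ a → Distinct (φ a)
          mono   : ∀ a i → typ a i ∈ ps → c (typ a i , φ a i) ≡ colour (typ a i)

      copy₀ : ∀ c → Copy picture₀ [] c
      copy₀ c = record
        { φ = point₀ ; colour = λ _ → colour₀
        ; φ∈ = λ a i → ∈-cartesianProductWith⁺ _ (∈-allFin a) (∈-allFin i)
        ; line = point₀-line ; inj = λ a i j eq → cong Vec.head eq ; mono = λ _ _ () }

      -- Hales-Jewett over `part` yields a word `w` along which all points of type `p` get one
      -- colour. The copy found inside the corresponding copy of `Π` then takes care of `ps`.
      copy-step : ∀ {d} (Π : Picture d) ps p → (∀ c → Copy Π ps c) →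
        Σ ℕ λ h → ∀ c → Copy (amalgam Π p h) (p ∷ ps) c
      copy-step {d} Π ps p copies = h , λ c → new c (proj₂ hj (λ v → c (p , proj₁ p ++ concat v)))
        where
        B = part Π p
        hj : HalesJewett B B r
        hj = hales-jewett B B (λ x → x) r
        h = proj₁ hj
        new : (c : Type × Point k (n + h * d) → Fin r) → MonoLine B B (λ v → c (p , proj₁ p ++ concat v)) → Copy (amalgam Π p h) (p ∷ ps) c
        new c (w , w-var , w-let , w-mono) = record
          { φ = λ a i → base a i ++ concat (subst-var (φ a i) w)
          ; colour = colour′
          ; φ∈ = λ a i → ∈-cartesianProductWith⁺ (embed Π p) (∈-varWords⁺ w-var w-let) (φ∈ a i)
          ; line = λ a → weakLine-++ {u = base a} (base-line a)
              (weakLine-concat {u = λ i → subst-var (φ a i) w} (weakLine-subst {η = φ a} w (line a)))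
          ; inj = λ a i j eq → base-inj a i j (Vecₚ.++-injectiveˡ (base a i) (base a j) eq)
          ; mono = λ a i → mono′ a i
          }
          where
          open Copy (copies (λ y → c (embed Π p {h} w y)))
          common : ∀ {B′} → B′ ≡ B → Σ (Fin r) λ γ → ∀ {x} → x ∈ B → c (embed Π p w (p , x)) ≡ γ
          -- With no points of type `p` the colour assigned to `p` is arbitrary.
          common {[]} eq = colour₀ , λ x∈ → ⊥-elim (empty (subst (_ ∈_) (sym eq) x∈))
            where
            empty : ∀ {x : Point k d} → ¬ (x ∈ [])
            empty ()
          common {b ∷ _} eq = c (embed Π p w (p , b)) , λ x∈ → w-mono x∈ (subst (b ∈_) eq (here refl))
          γ = proj₁ (common refl)
          colour′ : Type → Fin r
          colour′ t with t ≟T p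
          ... | yes _ = γ
          ... | no _ = colour t
          mono′ : ∀ a i → typ a i ∈ p ∷ ps → c (embed Π p w (typ a i , φ a i)) ≡ colour′ (typ a i)
          mono′ a i t∈ with typ a i ≟T p
          ... | yes eq = trans (cong (λ t → c (embed Π p w (t , φ a i))) eq)
                          (proj₂ (common refl) (∈-part⁺ Π p (subst (λ t → (t , φ a i) ∈ Π) eq (φ∈ a i))))
          mono′ a i (here eq) | no ne = ⊥-elim (ne eq)
          mono′ a i (there t∈) | no ne = mono a i t∈

      record RamseyPicture (ps : List Type) : Set where
        field
          {dim}    : ℕ
          picture  : Picture dim
          coherent : Coherent picture
          typed    : ∀ {y} → y ∈ picture → ∃ λ a → ∃ λ i → proj₁ y ≡ typ a i
          copies   : ∀ c → Copy picture ps c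

      partite-construction : ∀ ps → RamseyPicture ps
      partite-construction [] = record
        { picture = picture₀ ; coherent = picture₀-coherent ; typed = typed₀ ; copies = copy₀ }
        where
        typed₀ : ∀ {y} → y ∈ picture₀ → ∃ λ a → ∃ λ i → proj₁ y ≡ typ a i
        typed₀ y∈ with ∈-cartesianProductWith⁻ _ (List.allFin m) (List.allFin k) y∈
        ... | a , i , _ , _ , eq = a , i , cong proj₁ eq
      partite-construction (p ∷ ps) = record
        { picture = amalgam picture p (proj₁ next)
        ; coherent = amalgam-coherent picture p coherent (proj₁ next)
        ; typed = typed′
        ; copies = proj₂ next
        }
        where
        open RamseyPicture (partite-construction ps)
        next = copy-step picture ps p copies
        typed′ : ∀ {y} → y ∈ amalgam picture p (proj₁ next) → ∃ λ a → ∃ λ i → proj₁ y ≡ typ a i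
        typed′ y∈ with ∈-cartesianProductWith⁻ (embed picture p) (varWords (part picture p) (proj₁ next)) picture y∈
        ... | w , x , _ , x∈ , refl = typed x∈

-- The shift hypergraph

-- Each entry serves as the bound for the rest, so the list is strictly decreasing.
Desc : ℕ → List ℕ → Set
Desc N [] = ⊤
Desc N (w ∷ ws) = w < N × Desc w ws

desc? : ∀ N ws → Dec (Desc N ws)
desc? N [] = yes tt
desc? N (w ∷ ws) = (w <? N) ×-dec desc? w ws

desc-weaken : ∀ {M N} W → M ≤ N → Desc M W → Desc N W
desc-weaken [] _ _ = tt
desc-weaken (w ∷ W) M≤N (w<M , W↓) = <-≤-trans w<M M≤N , W↓

desc-take : ∀ {N} n W → Desc N W → Desc N (take n W)
desc-take zero W _ = tt
desc-take (suc n) [] _ = tt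
desc-take (suc n) (w ∷ W) (w<N , W↓) = w<N , desc-take n W W↓

desc-drop : ∀ {N} n W → Desc N W → Desc N (drop n W)
desc-drop zero W W↓ = W↓
desc-drop (suc n) [] _ = tt
desc-drop (suc n) (w ∷ W) (w<N , W↓) = desc-weaken (drop n W) (<⇒≤ w<N) (desc-drop n W W↓)

length-window : ∀ {l m i} (D : List ℕ) → length D ≡ l + m → i ≤ l → length (take m (drop i D)) ≡ m
length-window {l} {m} {i} D len i≤l = trans (length-take m (drop i D)) (m≤n⇒m⊓n≡m (begin
  m                    ≤⟨ m≤n+m m (l ∸ i) ⟩
  l ∸ i + m            ≡⟨ +-∸-comm m i≤l ⟨
  l + m ∸ i            ≡⟨ cong (_∸ i) len ⟨
  length D ∸ i         ≡⟨ length-drop i D ⟨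
  length (drop i D)    ∎))
  where open ≤-Reasoning

descLists : ℕ → ℕ → List (List ℕ)
descLists N zero = [] ∷ []
descLists zero (suc l) = []
descLists (suc N) (suc l) = List.map (N ∷_) (descLists N l) List.++ descLists N (suc l)

∈-descLists⁺ : ∀ N {l} W → Desc N W → length W ≡ l → W ∈ descLists N l
∈-descLists⁺ N [] _ refl = here refl
∈-descLists⁺ (suc N) (w ∷ W) (w<sN , W↓) refl with w ≟ N
... | yes refl = ∈-++⁺ˡ (∈-map⁺ (N ∷_) (∈-descLists⁺ N W W↓ refl))
... | no w≢N = ∈-++⁺ʳ (List.map (N ∷_) (descLists N (length W)))
                 (∈-descLists⁺ N (w ∷ W) (≤∧≢⇒< (≤-pred w<sN) w≢N , W↓) refl)

∈-descLists⁻ : ∀ N l {W} → W ∈ descLists N l → Desc N W × length W ≡ l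
∈-descLists⁻ N zero (here refl) = tt , refl
∈-descLists⁻ (suc N) (suc l) W∈ with ∈-++⁻ (List.map (N ∷_) (descLists N l)) W∈
... | inj₂ W∈′ = let W↓ , len = ∈-descLists⁻ N (suc l) W∈′ in desc-weaken _ (n≤1+n N) W↓ , len
... | inj₁ W∈′ with ∈-map⁻ (N ∷_) W∈′
...   | V , V∈ , refl = let V↓ , len = ∈-descLists⁻ N l V∈ in (≤-refl , V↓) , cong suc len

-- The Ramsey property of the shift hypergraph on `m`-tuples whose edges consist of `suc l`
-- consecutive windows.
Windows : ℕ → ℕ → ℕ → Set
Windows m l r = Σ ℕ λ N → (c : List ℕ → Fin r) → Σ (List ℕ) λ D → Desc N D × length D ≡ l + m ×
  Σ (Fin r) λ γ → ∀ i → i ≤ l → c (take m (drop i D)) ≡ γ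

windows-one : ∀ r → Windows 1 1 r
windows-one r = suc r , λ c → find c (pigeonhole (n<1+n r) (λ i → c (toℕ i ∷ [])))
  where
  find : (c : List ℕ → Fin r) → _ → _
  find c (i , j , i<j , eq) = toℕ j ∷ toℕ i ∷ [] , (toℕ<n j , i<j , tt) , refl , c (toℕ i ∷ []) ,
    λ { zero _ → sym eq ; (suc zero) _ → refl ; (suc (suc _)) (s≤s ()) }

module Extension (m′ N : ℕ) {r : ℕ} (c : List ℕ → Fin r) where

  m : ℕ
  m = suc m′

  -- ℓ larger labels can be put in front of A so that the ℓ windows of length suc m starting there have colour γ.
  Ext : Fin r → ℕ → List ℕ → Set
  Ext γ zero A = ⊤
  Ext γ (suc ℓ) A = ∃ λ x → x < N × Desc x A × c (x ∷ A) ≡ γ × Ext γ ℓ (take m (x ∷ A))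

  ext? : ∀ γ ℓ A → Dec (Ext γ ℓ A)
  ext? γ zero A = yes tt
  ext? γ (suc ℓ) A = anyUpTo? (λ x → desc? x A ×-dec (c (x ∷ A) Fin.≟ γ ×-dec ext? γ ℓ (take m (x ∷ A)))) N

  bit : ∀ {P : Set} → Dec P → Fin 2
  bit (yes _) = zero
  bit (no _) = suc zero

  bit-≡ : ∀ {P Q : Set} (P? : Dec P) (Q? : Dec Q) → bit P? ≡ bit Q? → P → Q
  bit-≡ _ (yes q) _ _ = q
  bit-≡ (no ¬p) (no _) _ p = ⊥-elim (¬p p)

  -- A finite colouring that stores the truth values of `Ext γ ℓ A` for all colours `γ` and all
  -- `ℓ ≤ l`.
  profile : ∀ l → List ℕ → Fin ((2 ^ r) ^ suc l)
  profile l A = funToFin {suc l} λ ℓ → funToFin λ γ → bit (ext? γ (toℕ ℓ) A)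

  profile-≡ : ∀ l A A′ → profile l A ≡ profile l A′ → ∀ γ ℓ → ℓ ≤ l → Ext γ ℓ A → Ext γ ℓ A′
  profile-≡ l A A′ eq γ ℓ ℓ≤ = subst (λ ℓ → Ext γ ℓ A → Ext γ ℓ A′) (toℕ-fromℕ< (s≤s ℓ≤)) (bit-≡ (ext? γ _ A) (ext? γ _ A′) bits)
    where
    f = fromℕ< (s≤s ℓ≤)
    row : List ℕ → Fin (suc l) → Fin (2 ^ r)
    row A ℓ = funToFin λ γ → bit (ext? γ (toℕ ℓ) A)
    rows : row A f ≡ row A′ f
    rows = trans (sym (finToFun-funToFin (row A) f)) (trans (cong (λ e → finToFun {2 ^ r} {suc l} e f) eq) (finToFun-funToFin (row A′) f))
    bits : bit (ext? γ (toℕ f) A) ≡ bit (ext? γ (toℕ f) A′)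
    bits = trans (sym (finToFun-funToFin (λ γ → bit (ext? γ (toℕ f) A)) γ))
          (trans (cong (λ e → finToFun {2} {r} e γ) rows) (finToFun-funToFin (λ γ → bit (ext? γ (toℕ f) A′)) γ))

  desc-take⁻ : ∀ x D → Desc x (take m D) → Desc N D → Desc x D
  desc-take⁻ x [] _ _ = tt
  desc-take⁻ x (d ∷ D) (d<x , _) (_ , D↓) = d<x , D↓

  take-take : ∀ n (D : List ℕ) → take n (take (suc n) D) ≡ take n D
  take-take zero D = refl
  take-take (suc n) [] = refl
  take-take (suc n) (x ∷ D) = cong (x ∷_) (take-take n D)

  unfold : ∀ γ ℓ D → Desc N D → Ext γ ℓ (take m D) → Σ (List ℕ) λ E → Desc N E × length E ≡ ℓ + length D ×
    drop ℓ E ≡ D × (∀ i → i < ℓ → c (take (suc m) (drop i E)) ≡ γ)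
  unfold γ zero D D↓ _ = D , D↓ , refl , refl , λ _ ()
  unfold γ (suc ℓ) D D↓ (x , x<N , x>D , cx , ext)
    with unfold γ ℓ (x ∷ D) (x<N , desc-take⁻ x D x>D D↓) (subst (λ A → Ext γ ℓ (x ∷ A)) (take-take m′ D) ext)
  ... | E , E↓ , len , dr , mono = E , E↓ , trans len (+-suc ℓ (length D)) , drop-suc ℓ E dr , λ i i<sℓ → last i (≤-pred i<sℓ)
    where
    drop-suc : ∀ ℓ (E : List ℕ) {y F} → drop ℓ E ≡ y ∷ F → drop (suc ℓ) E ≡ F
    drop-suc zero (_ ∷ _) refl = refl
    drop-suc (suc ℓ) (_ ∷ E) eq = drop-suc ℓ E eq
    last : ∀ i → i ≤ ℓ → c (take (suc m) (drop i E)) ≡ γ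
    last i i≤ℓ with i <? ℓ
    ... | yes i<ℓ = mono i i<ℓ
    ... | no i≮ℓ with refl ← ≤-antisym i≤ℓ (≮⇒≥ i≮ℓ) = trans (cong (λ F → c (take (suc m) F)) dr) cx

  -- An extension of `A` by `ℓ` labels yields, by equality of profiles, one of the window starting
  -- with `d`; counting `d` as well, this extends `A` by `suc ℓ` labels.
  climb : ∀ l d A → d < N → Desc d A → profile (suc l) (take m (d ∷ A)) ≡ profile (suc l) A →
    ∀ ℓ → ℓ ≤ suc l → Ext (c (d ∷ A)) ℓ A
  climb l d A d<N A↓ eq zero _ = tt
  climb l d A d<N A↓ eq (suc ℓ) ℓ<l = d , d<N , A↓ , refl ,
    profile-≡ (suc l) A (take m (d ∷ A)) (sym eq) _ ℓ (<⇒≤ ℓ<l) (climb l d A d<N A↓ eq ℓ (<⇒≤ ℓ<l))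

-- Tuples shorter by one are coloured by their profiles. Two consecutive windows of equal profile
-- can be climbed `suc l` times, so edges with two windows yield edges with any number of windows
-- one length higher.
windows-suc : ∀ m′ l r → (∀ r → Windows (suc m′) 1 r) → Windows (2 + m′) l r
windows-suc m′ l r IH = N , result
  where
  m = suc m′
  W = IH ((2 ^ r) ^ suc (suc l))
  N = proj₁ W
  result : (c : List ℕ → Fin r) → Σ (List ℕ) λ D → Desc N D × length D ≡ l + suc m ×
    Σ (Fin r) λ γ → ∀ i → i ≤ l → c (take (suc m) (drop i D)) ≡ γ
  result c with proj₂ W (Extension.profile m′ N c (suc l))
  ... | d ∷ A , (d<N , A↓) , len , δ , same
    with Extension.unfold m′ N c (c (d ∷ A)) (suc l) A A↓N (subst (Extension.Ext m′ N c _ (suc l)) (sym full)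
           (Extension.climb m′ N c l d A d<N A↓ profiles (suc l) ≤-refl))
    where
    lenA : length A ≡ m
    lenA = suc-injective len
    full : take m A ≡ A
    full = take-all m A (≤-reflexive lenA)
    A↓N : Desc N A
    A↓N = desc-weaken A (<⇒≤ d<N) A↓
    profiles : Extension.profile m′ N c (suc l) (take m (d ∷ A)) ≡ Extension.profile m′ N c (suc l) A
    profiles = trans (same 0 z≤n) (trans (sym (same 1 ≤-refl)) (cong (Extension.profile m′ N c (suc l)) full))
  ... | E , E↓ , lenE , _ , mono = E , E↓ ,
    trans lenE (trans (cong (suc l +_) (suc-injective len)) (sym (+-suc l m))) ,
    c (d ∷ A) , λ i i≤l → mono i (s≤s i≤l)

windows-two : ∀ m r → Windows (suc m) 1 r
windows-two zero r = windows-one r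
windows-two (suc m) r = windows-suc m 1 r (windows-two m)

windows : ∀ m l r → Windows (2 + m) l r
windows m l r = windows-suc m l r (windows-two m)

-- The acceptance test on marked tuples

module Marker (K : ℕ) where

  -- Reads bits up to the first `true`; `accept 0` asks for its position to be no multiple of suc K.
  accept : ℕ → List Bool → Bool
  accept _ [] = false
  accept zero (true ∷ _) = false
  accept zero (false ∷ bs) = accept K bs
  accept (suc n) (true ∷ _) = true
  accept (suc n) (false ∷ bs) = accept n bs

  Rejected : List Bool → Set
  Rejected bs = ∀ m → accept 0 (take m bs) ≡ false

  accept-replicate : ∀ n {bs} → Rejected bs → ∀ m → accept n (take m (replicate n false List.++ bs)) ≡ false
  accept-replicate zero rej m = rej m
  accept-replicate (suc n) rej zero = refl
  accept-replicate (suc n) rej (suc m) = accept-replicate n rej m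

  -- Asking for rejection of all truncations makes the recursion work, since removing a leading bit
  -- shifts the end of the window.
  split-rejected : ∀ bs → ∃ λ i → i ≤ K × ∃ λ cs → bs ≡ replicate i false List.++ cs × Rejected cs
  split-rejected [] = 0 , z≤n , [] , refl , λ { zero → refl ; (suc m) → refl }
  split-rejected (true ∷ bs) = 0 , z≤n , true ∷ bs , refl , λ { zero → refl ; (suc m) → refl }
  split-rejected (false ∷ bs) with split-rejected bs
  ... | i , i≤K , cs , eq , rej with i <? K
  ...   | yes i<K = suc i , i<K , cs , cong (false ∷_) eq , rej
  -- After `suc K` unmarked entries the counter is back at 0, so the rejection of `cs` makes the
  -- whole list rejected.
  ...   | no i≮K with refl ← ≤-antisym i≤K (≮⇒≥ i≮K) = 0 , z≤n , false ∷ bs , refl ,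
            λ { zero → refl ; (suc m) → trans (cong (λ l → accept K (take m l)) eq) (accept-replicate K rej m) }

  drop-replicate : ∀ i {cs : List Bool} → drop i (replicate i false List.++ cs) ≡ cs
  drop-replicate zero = refl
  drop-replicate (suc i) = drop-replicate i

  some-rejected : ∀ bs m → ∃ λ i → i ≤ K × accept 0 (take m (drop i bs)) ≡ false
  some-rejected bs m with split-rejected bs
  ... | i , i≤K , cs , refl , rej = i , i≤K , trans (cong (λ l → accept 0 (take m l)) (drop-replicate i)) (rej m)

-- Counting over random markings

⟦_⟧ : Bool → ℕ
⟦ true ⟧ = 1
⟦ false ⟧ = 0

update : (ℕ → Bool) → ℕ → Bool → ℕ → Bool
update g N b x = if does (x ≟ N) then b else g x

module Weight (Q : ℕ) where

  R : ℕ
  R = suc Q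

  -- Sum over R ^ N equally likely assignments: each label below N gets `true` in one case out of R.
  total : ℕ → ((ℕ → Bool) → ℕ) → ℕ
  total zero F = F (λ _ → false)
  total (suc N) F = total N (λ g → F (update g N true)) + Q * total N (λ g → F (update g N false))

  total-cong : ∀ N {F G} → (∀ g → F g ≡ G g) → total N F ≡ total N G
  total-cong zero eq = eq _
  total-cong (suc N) eq = cong₂ (λ a b → a + Q * b) (total-cong N (λ g → eq _)) (total-cong N (λ g → eq _))

  total-const : ∀ N v → total N (λ _ → v) ≡ R ^ N * v
  total-const zero v = sym (*-identityˡ v)
  total-const (suc N) v = trans (cong (λ t → t + Q * t) (total-const N v)) (sym (*-assoc R (R ^ N) v))

  total-+ : ∀ N F G → total N (λ g → F g + G g) ≡ total N F + total N G
  total-+ zero F G = refl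
  total-+ (suc N) F G rewrite total-+ N (λ g → F (update g N true)) (λ g → G (update g N true))
                            | total-+ N (λ g → F (update g N false)) (λ g → G (update g N false)) = lemma (total N (λ g → F (update g N true))) (total N (λ g → G (update g N true))) (total N (λ g → F (update g N false))) (total N (λ g → G (update g N false))) Q
    where
    lemma : ∀ a b c d Q → a + b + Q * (c + d) ≡ a + Q * c + (b + Q * d)
    lemma = solve-∀

  total-* : ∀ N v F → total N (λ g → v * F g) ≡ v * total N F
  total-* zero v F = refl
  total-* (suc N) v F rewrite total-* N v (λ g → F (update g N true)) | total-* N v (λ g → F (update g N false)) = lemma v _ _ Q
    where
    lemma : ∀ v a b Q → v * a + Q * (v * b) ≡ v * (a + Q * b)
    lemma = solve-∀

  pick : ∀ N F v → R ^ N * v ≤ total N F → ∃ λ g → v ≤ F g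
  pick zero F v le = _ , subst (λ x → x ≤ F (λ _ → false)) (*-identityˡ v) le
  pick (suc N) F v le with R ^ N * v ≤? total N (λ g → F (update g N true))
  ... | yes le₁ = let g , p = pick N _ v le₁ in update g N true , p
  ... | no gt with R ^ N * v ≤? total N (λ g → F (update g N false))
  ...   | yes le₂ = let g , p = pick N _ v le₂ in update g N false , p
  ...   | no gt₂ = ⊥-elim (<⇒≱ (+-mono-<-≤ (≰⇒> gt) (*-monoʳ-≤ Q (<⇒≤ (≰⇒> gt₂)))) (subst (λ x → x ≤ total (suc N) F) (*-assoc R (R ^ N) v) le))

  update-≡ : ∀ g N b → update g N b N ≡ b
  update-≡ g N b rewrite dec-true (N ≟ N) refl = refl

  map-update : ∀ g N b W → Desc N W → map (update g N b) W ≡ map g W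
  map-update g N b W W↓ = go N ≤-refl W W↓
    where
    go : ∀ M → M ≤ N → ∀ W → Desc M W → map (update g N b) W ≡ map g W
    go M M≤N [] _ = refl
    go M M≤N (w ∷ W) (w<M , W↓) = cong₂ _∷_ head (go w (<⇒≤ w<N) W W↓)
      where
      w<N = <-≤-trans w<M M≤N
      head : update g N b w ≡ g w
      head rewrite dec-false (w ≟ N) (<⇒≢ w<N) = refl

  module _ (K : ℕ) where
    open Marker K

    -- The number, out of `R ^ m`, of markings of `m` distinct labels that are accepted from counter
    -- state `n`.
    accepted : ℕ → ℕ → ℕ
    accepted zero n = 0
    accepted (suc m) zero = Q * accepted m K
    accepted (suc m) (suc n) = R ^ m + Q * accepted m n

    -- The entries of `W` are distinct, so their marks are independent and the acceptance
    -- probability depends on the length only. Both denominators are cleared.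
    total-accept : ∀ N W n → Desc N W → R ^ length W * total N (λ g → ⟦ accept n (map g W) ⟧) ≡ R ^ N * accepted (length W) n
    total-accept N [] n _ = trans (*-identityˡ _) (total-const N 0)
    total-accept zero (w ∷ W) n (() , _)
    total-accept (suc N) (w ∷ W) n (w<sN , W↓) with w ≟ N
    ... | no w≢N = begin
        R ^ suc (length W) * (total N (λ g → ⟦ accept n (map (update g N true) (w ∷ W)) ⟧) + Q * total N (λ g → ⟦ accept n (map (update g N false) (w ∷ W)) ⟧))
          ≡⟨ cong₂ (λ a b → R ^ suc (length W) * (a + Q * b)) (drop-update true) (drop-update false) ⟩
        R ^ suc (length W) * (R * t)          ≡⟨ swap (R ^ suc (length W)) R t ⟩
        R * (R ^ suc (length W) * t)          ≡⟨ cong (R *_) (total-accept N (w ∷ W) n W↓′) ⟩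
        R * (R ^ N * accepted (suc (length W)) n)   ≡⟨ *-assoc R (R ^ N) _ ⟨
        R ^ suc N * accepted (suc (length W)) n     ∎
      where
      open ≡-Reasoning
      t = total N (λ g → ⟦ accept n (map g (w ∷ W)) ⟧)
      W↓′ : Desc N (w ∷ W)
      W↓′ = ≤∧≢⇒< (≤-pred w<sN) w≢N , W↓
      drop-update : ∀ b → total N (λ g → ⟦ accept n (map (update g N b) (w ∷ W)) ⟧) ≡ t
      drop-update b = total-cong N (λ g → cong (λ l → ⟦ accept n l ⟧) (map-update g N b (w ∷ W) W↓′))
      swap : ∀ a b c → a * (b * c) ≡ b * (a * c)
      swap = solve-∀
    ... | yes refl = step n
      where
      open ≡-Reasoning
      bits : ∀ g b → map (update g N b) (N ∷ W) ≡ b ∷ map g W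
      bits g b = cong₂ _∷_ (update-≡ g N b) (map-update g N b W W↓)
      t : ℕ → ℕ
      t n = total N (λ g → ⟦ accept n (map g W) ⟧)
      peel : ∀ n → total (suc N) (λ g → ⟦ accept n (map g (N ∷ W)) ⟧) ≡
        total N (λ g → ⟦ accept n (true ∷ map g W) ⟧) + Q * total N (λ g → ⟦ accept n (false ∷ map g W) ⟧)
      peel n = cong₂ (λ a b → a + Q * b) (total-cong N (λ g → cong (λ l → ⟦ accept n l ⟧) (bits g true)))
                                         (total-cong N (λ g → cong (λ l → ⟦ accept n l ⟧) (bits g false)))
      step : ∀ n → R ^ suc (length W) * total (suc N) (λ g → ⟦ accept n (map g (N ∷ W)) ⟧) ≡ R ^ suc N * accepted (suc (length W)) n
      step zero = begin
        R ^ suc (length W) * total (suc N) (λ g → ⟦ accept 0 (map g (N ∷ W)) ⟧) ≡⟨ cong (R ^ suc (length W) *_) (trans (peel 0) (cong (_+ Q * t K) (trans (total-const N 0) (*-zeroʳ (R ^ N))))) ⟩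
        R * R ^ length W * (Q * t K)   ≡⟨ move R (R ^ length W) Q (t K) ⟩
        R * Q * (R ^ length W * t K)   ≡⟨ cong (R * Q *_) (total-accept N W K W↓) ⟩
        R * Q * (R ^ N * accepted (length W) K)  ≡⟨ move R (R ^ N) Q _ ⟨
        R * R ^ N * (Q * accepted (length W) K)  ∎
        where
        move : ∀ a b c d → a * b * (c * d) ≡ a * c * (b * d)
        move = solve-∀
      step (suc n) = begin
        R ^ suc (length W) * total (suc N) (λ g → ⟦ accept (suc n) (map g (N ∷ W)) ⟧) ≡⟨ cong (R ^ suc (length W) *_) (trans (peel (suc n)) (cong (_+ Q * t n) (trans (total-const N 1) (*-identityʳ (R ^ N))))) ⟩
        R * R ^ length W * (R ^ N + Q * t n)   ≡⟨ move R (R ^ length W) (R ^ N) Q (t n) ⟩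
        R * (R ^ length W * R ^ N + Q * (R ^ length W * t n))   ≡⟨ cong (λ z → R * (R ^ length W * R ^ N + Q * z)) (total-accept N W n W↓) ⟩
        R * (R ^ length W * R ^ N + Q * (R ^ N * accepted (length W) n))  ≡⟨ back R (R ^ length W) (R ^ N) Q _ ⟩
        R * R ^ N * (R ^ length W + Q * accepted (length W) n)  ∎
        where
        move : ∀ a b c d e → a * b * (c + d * e) ≡ a * (b * c + d * (b * e))
        move = solve-∀
        back : ∀ a b c d e → a * (b * c + d * (c * e)) ≡ a * c * (b + d * e)
        back = solve-∀

    -- Divided by `R * suc K * R ^ m`: the acceptance probability from state `n` is at least
    -- `(K * R + n - K) / (R * suc K)` minus `K / suc K` times `(Q / R) ^ m`, the probability that
    -- nothing is marked. The bound is linear in `n` so that it survives the recursion.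
    accepted-bound : ∀ m n → n ≤ K →
      K * R * R ^ m + n * R ^ m ≤ R * suc K * accepted m n + K * R ^ m + K * R * Q ^ m
    accepted-bound zero n n≤K = begin
      K * R * 1 + n * 1                  ≡⟨ +-comm (K * R * 1) (n * 1) ⟩
      n * 1 + K * R * 1                  ≤⟨ +-monoˡ-≤ (K * R * 1) (*-monoˡ-≤ 1 n≤K) ⟩
      K * 1 + K * R * 1                  ≤⟨ +-monoˡ-≤ (K * R * 1) (m≤n+m (K * 1) (R * suc K * 0)) ⟩
      R * suc K * 0 + K * 1 + K * R * 1  ∎
      where open ≤-Reasoning
    -- From state 0 the estimate for state `K` is inherited without loss.
    accepted-bound (suc m) zero _ = +-cancelʳ-≤ (Q * (K * R ^ m)) _ _ (begin
      K * R * (R * R ^ m) + 0 * (R * R ^ m) + Q * (K * R ^ m)  ≡⟨ eq₁ K Q (R ^ m) ⟩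
      Q * (K * R * R ^ m + K * R ^ m) + K * (R * R ^ m)   ≤⟨ +-monoˡ-≤ _ (*-monoʳ-≤ Q (accepted-bound m K ≤-refl)) ⟩
      Q * (R * suc K * accepted m K + K * R ^ m + K * R * Q ^ m) + K * (R * R ^ m) ≡⟨ eq₂ K Q (R ^ m) (accepted m K) (Q ^ m) ⟩
      R * suc K * (Q * accepted m K) + K * (R * R ^ m) + K * R * (Q * Q ^ m) + Q * (K * R ^ m) ∎)
      where
      open ≤-Reasoning
      eq₁ : ∀ K Q x → K * suc Q * (suc Q * x) + 0 * (suc Q * x) + Q * (K * x) ≡ Q * (K * suc Q * x + K * x) + K * (suc Q * x)
      eq₁ = solve-∀
      eq₂ : ∀ K Q x a y → Q * (suc Q * suc K * a + K * x + K * suc Q * y) + K * (suc Q * x) ≡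
        suc Q * suc K * (Q * a) + K * (suc Q * x) + K * suc Q * (Q * y) + Q * (K * x)
      eq₂ = solve-∀
    -- Here the slack is `e * R ^ m` with `e = K - n`.
    accepted-bound (suc m) (suc n) n<K = +-cancelʳ-≤ (Q * (K * R ^ m)) _ _ (begin
      K * R * (R * R ^ m) + suc n * (R * R ^ m) + Q * (K * R ^ m)  ≡⟨ cong (λ K → K * R * (R * R ^ m) + suc n * (R * R ^ m) + Q * (K * R ^ m)) K≡ ⟨
      (n + e) * R * (R * R ^ m) + suc n * (R * R ^ m) + Q * ((n + e) * R ^ m)  ≤⟨ m≤m+n _ (e * R ^ m) ⟩
      (n + e) * R * (R * R ^ m) + suc n * (R * R ^ m) + Q * ((n + e) * R ^ m) + e * R ^ m ≡⟨ eq₁ n e Q (R ^ m) ⟩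
      Q * ((n + e) * R * R ^ m + n * R ^ m) + (n + e) * (R * R ^ m) + R * suc (n + e) * R ^ m  ≡⟨ cong (λ K → Q * (K * R * R ^ m + n * R ^ m) + K * (R * R ^ m) + R * suc K * R ^ m) K≡ ⟩
      Q * (K * R * R ^ m + n * R ^ m) + K * (R * R ^ m) + R * suc K * R ^ m  ≤⟨ +-monoˡ-≤ _ (+-monoˡ-≤ _ (*-monoʳ-≤ Q (accepted-bound m n (<⇒≤ n<K)))) ⟩
      Q * (R * suc K * accepted m n + K * R ^ m + K * R * Q ^ m) + K * (R * R ^ m) + R * suc K * R ^ m ≡⟨ eq₂ K Q (R ^ m) (accepted m n) (Q ^ m) ⟩
      R * suc K * (R ^ m + Q * accepted m n) + K * (R * R ^ m) + K * R * (Q * Q ^ m) + Q * (K * R ^ m) ∎)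
      where
      open ≤-Reasoning
      e = K ∸ n
      K≡ : n + e ≡ K
      K≡ = m+[n∸m]≡n (<⇒≤ n<K)
      eq₁ : ∀ n e Q x → (n + e) * suc Q * (suc Q * x) + suc n * (suc Q * x) + Q * ((n + e) * x) + e * x ≡
        Q * ((n + e) * suc Q * x + n * x) + (n + e) * (suc Q * x) + suc Q * suc (n + e) * x
      eq₁ = solve-∀
      eq₂ : ∀ K Q x a y → Q * (suc Q * suc K * a + K * x + K * suc Q * y) + K * (suc Q * x) + suc Q * suc K * x ≡
        suc Q * suc K * (x + Q * a) + K * (suc Q * x) + K * suc Q * (Q * y) + Q * (K * x)
      eq₂ = solve-∀

  -- Bernoulli's inequality for the `m`-th power of `1 + 1 / Q`, without fractions.
  bernoulli : ∀ m → Q ^ m * (Q + m) ≤ Q * R ^ m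
  bernoulli zero = ≤-reflexive (eq Q)
    where
    eq : ∀ Q → 1 * (Q + 0) ≡ Q * 1
    eq = solve-∀
  bernoulli (suc m) = begin
    Q * Q ^ m * (Q + suc m)            ≤⟨ m≤m+n _ (Q ^ m * m) ⟩
    Q * Q ^ m * (Q + suc m) + Q ^ m * m ≡⟨ eq₁ Q (Q ^ m) m ⟩
    R * (Q ^ m * (Q + m))              ≤⟨ *-monoʳ-≤ R (bernoulli m) ⟩
    R * (Q * R ^ m)                    ≡⟨ eq₂ Q (R ^ m) ⟩
    Q * (R * R ^ m)                    ∎
    where
    open ≤-Reasoning
    eq₁ : ∀ Q x m → Q * x * (Q + suc m) + x * m ≡ suc Q * (x * (Q + m))
    eq₁ = solve-∀
    eq₂ : ∀ Q y → suc Q * (Q * y) ≡ Q * (suc Q * y)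
    eq₂ = solve-∀

  R-power-dominates : .{{_ : NonZero Q}} → ∀ m → Q * Q ≤ m → R * Q ^ m ≤ R ^ m
  R-power-dominates m Q²≤m = *-cancelˡ-≤ Q (begin
    Q * (R * Q ^ m)      ≡⟨ eq Q (Q ^ m) ⟩
    Q ^ m * (Q + Q * Q)  ≤⟨ *-monoʳ-≤ (Q ^ m) (+-monoʳ-≤ Q Q²≤m) ⟩
    Q ^ m * (Q + m)      ≤⟨ bernoulli m ⟩
    Q * R ^ m            ∎)
    where
    open ≤-Reasoning
    eq : ∀ Q x → Q * (suc Q * x) ≡ x * (Q + Q * Q)
    eq = solve-∀

  -- With R = 2 q K each of the two error terms of accepted-bound is at most half of the gap q K − p (K + 1) ≥ 1.
  accepted-large : .{{_ : NonZero Q}} → ∀ K p q m → p * suc K < q * K → R ≡ 2 * (q * K) → Q * Q ≤ m →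
    p * R ^ m ≤ q * accepted K m 0
  accepted-large K p q m gap R≡ Q²≤m = *-cancelˡ-≤ (2 * (R * suc K)) (+-cancelʳ-≤ (2 * (q * (K * R ^ m + K * R * Q ^ m))) _ _ (begin
      2 * (R * suc K) * (p * X) + 2 * (q * (K * X + K * R * Y))   ≡⟨ eq₁ R K p q X Y ⟩
      2 * (R * X) * (p * suc K) + 2 * (q * K) * X + R * (2 * (q * K) * Y)  ≡⟨ cong (λ z → 2 * (R * X) * (p * suc K) + z * X + R * (z * Y)) R≡ ⟨
      2 * (R * X) * (p * suc K) + R * X + R * (R * Y)      ≤⟨ +-monoʳ-≤ (2 * (R * X) * (p * suc K) + R * X) (*-monoʳ-≤ R (R-power-dominates m Q²≤m)) ⟩
      2 * (R * X) * (p * suc K) + R * X + R * X            ≡⟨ eq₂ R X (p * suc K) ⟩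
      2 * (R * X) * suc (p * suc K)                        ≤⟨ *-monoʳ-≤ (2 * (R * X)) gap ⟩
      2 * (R * X) * (q * K)                                ≡⟨ eq₃ R X q K ⟩
      2 * (q * (K * R * X + 0 * X))                        ≤⟨ *-monoʳ-≤ 2 (*-monoʳ-≤ q (accepted-bound K m 0 z≤n)) ⟩
      2 * (q * (R * suc K * a + K * X + K * R * Y))        ≡⟨ eq₄ R K q X Y a ⟩
      2 * (R * suc K) * (q * a) + 2 * (q * (K * X + K * R * Y)) ∎))
    where
    open ≤-Reasoning
    X = R ^ m
    Y = Q ^ m
    a = accepted K m 0
    eq₁ : ∀ R K p q X Y → 2 * (R * suc K) * (p * X) + 2 * (q * (K * X + K * R * Y)) ≡
      2 * (R * X) * (p * suc K) + 2 * (q * K) * X + R * (2 * (q * K) * Y)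
    eq₁ = solve-∀
    eq₂ : ∀ R X b → 2 * (R * X) * b + R * X + R * X ≡ 2 * (R * X) * suc b
    eq₂ = solve-∀
    eq₃ : ∀ R X q K → 2 * (R * X) * (q * K) ≡ 2 * (q * (K * R * X + 0 * X))
    eq₃ = solve-∀
    eq₄ : ∀ R K q X Y a → 2 * (q * (R * suc K * a + K * X + K * R * Y)) ≡ 2 * (R * suc K) * (q * a) + 2 * (q * (K * X + K * R * Y))
    eq₄ = solve-∀

module _ {A B : Set} (_≟_ : DecidableEquality B) where

  -- Recovers a type for each bare point. Coherence applies to any choice of types occurring in the
  -- picture, so the first one will do; `a₀` is a default for points outside.
  firstLabel : A → List (A × B) → B → A
  firstLabel a₀ [] b = a₀
  firstLabel a₀ ((a , b′) ∷ xs) b with b′ ≟ b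
  ... | yes _ = a
  ... | no _ = firstLabel a₀ xs b

  firstLabel-∈ : ∀ a₀ xs b → b ∈ map proj₂ xs → (firstLabel a₀ xs b , b) ∈ xs
  firstLabel-∈ a₀ ((a , b′) ∷ xs) b b∈ with b′ ≟ b
  ... | yes refl = here refl
  firstLabel-∈ a₀ ((a , b′) ∷ xs) b (here eq) | no ne = ⊥-elim (ne (sym eq))
  firstLabel-∈ a₀ ((a , b′) ∷ xs) b (there b∈) | no ne = there (firstLabel-∈ a₀ xs b b∈)

-- Averaging over the markings

module Averaging (K Q : ℕ) {B : Set} (τ : B → List ℕ) where
  open Marker K
  open Weight Q

  accepts : (ℕ → Bool) → B → Bool
  accepts g y = accept 0 (map g (τ y))

  survivors : (ℕ → Bool) → List B → List B
  survivors g = filter (λ y → accepts g y Bool.≟ true)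

  survivors-∷ : ∀ g y Y → length (survivors g (y ∷ Y)) ≡ ⟦ accepts g y ⟧ + length (survivors g Y)
  survivors-∷ g y Y with accepts g y
  ... | true = refl
  ... | false = refl

  total-survivors : ∀ N p q Y → (∀ {y} → y ∈ Y → R ^ N * p ≤ q * total N (λ g → ⟦ accepts g y ⟧)) →
    R ^ N * (p * length Y) ≤ total N (λ g → q * length (survivors g Y))
  total-survivors N p q [] _ = ≤-trans (≤-reflexive (trans (cong (R ^ N *_) (*-zeroʳ p)) (*-zeroʳ (R ^ N)))) z≤n
  total-survivors N p q (y ∷ Y) each = begin
    R ^ N * (p * suc (length Y))                ≡⟨ eq (R ^ N) p (length Y) ⟩
    R ^ N * p + R ^ N * (p * length Y)          ≤⟨ +-mono-≤ (each (here refl)) (total-survivors N p q Y (each ∘ there)) ⟩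
    q * total N (λ g → ⟦ accepts g y ⟧) + total N (λ g → q * length (survivors g Y))
      ≡⟨ cong (_+ total N (λ g → q * length (survivors g Y))) (total-* N q (λ g → ⟦ accepts g y ⟧)) ⟨
    total N (λ g → q * ⟦ accepts g y ⟧) + total N (λ g → q * length (survivors g Y))
      ≡⟨ total-+ N (λ g → q * ⟦ accepts g y ⟧) (λ g → q * length (survivors g Y)) ⟨
    total N (λ g → q * ⟦ accepts g y ⟧ + q * length (survivors g Y))
      ≡⟨ total-cong N (λ g → trans (sym (*-distribˡ-+ q ⟦ accepts g y ⟧ _)) (cong (q *_) (sym (survivors-∷ g y Y)))) ⟩
    total N (λ g → q * length (survivors g (y ∷ Y)))  ∎
    where
    open ≤-Reasoning
    eq : ∀ a p l → a * (p * suc l) ≡ a * p + a * (p * l)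
    eq = solve-∀

  many-survivors : .{{_ : NonZero Q}} → ∀ N p q m → p * suc K < q * K → R ≡ 2 * (q * K) → Q * Q ≤ m →
    (Y : List B) → (∀ {y} → y ∈ Y → Desc N (τ y) × length (τ y) ≡ m) → ∃ λ g → p * length Y ≤ q * length (survivors g Y)
  many-survivors N p q m gap R≡ Q²≤m Y windowed = pick N _ _ (total-survivors N p q Y each)
    where
    each : ∀ {y} → y ∈ Y → R ^ N * p ≤ q * total N (λ g → ⟦ accepts g y ⟧)
    each {y} y∈ with windowed y∈
    ... | τ↓ , refl = *-cancelˡ-≤ (R ^ m) {{m^n≢0 R m}} (begin
      R ^ m * (R ^ N * p)             ≡⟨ eq₁ (R ^ m) (R ^ N) p ⟩
      R ^ N * (p * R ^ m)             ≤⟨ *-monoʳ-≤ (R ^ N) (accepted-large K p q m gap R≡ Q²≤m) ⟩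
      R ^ N * (q * accepted K m 0)    ≡⟨ eq₂ (R ^ N) q (accepted K m 0) ⟩
      q * (R ^ N * accepted K m 0)    ≡⟨ cong (q *_) (total-accept K N (τ y) 0 τ↓) ⟨
      q * (R ^ m * t)                 ≡⟨ eq₂ q (R ^ m) t ⟩
      R ^ m * (q * t)                 ∎)
      where
      open ≤-Reasoning
      t = total N (λ g → ⟦ accepts g y ⟧)
      eq₁ : ∀ a b c → a * (b * c) ≡ b * (c * a)
      eq₁ = solve-∀
      eq₂ : ∀ a b c → a * (b * c) ≡ b * (a * c)
      eq₂ = solve-∀

-- Assembling the point set

Conclusion : ℕ → ℕ → ℕ → ℕ → Set
Conclusion k r p q = Σ ℕ λ n → Σ (FinSet k n) λ X → IsSet X × RamseyForLines r X × DenseQuasilineFree p q X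

module Construction (k′ r m : ℕ) (W : Windows m (2 + k′) r)
    (hj : HalesJewett (allFin (3 + k′)) (allFin (3 + k′)) (r ^ length (descLists (proj₁ W) m))) where
  open PartiteConstruction k′

  K N n : ℕ
  K = 2 + k′
  N = proj₁ W
  n = proj₁ hj

  edges : List (VarWord (Fin k) n × List ℕ)
  edges = cartesianProduct (varWords (allFin k) n) (descLists N (K + m))

  edge-∈ : ∀ a → proj₁ (List.lookup edges a) ∈ varWords (allFin k) n × proj₂ (List.lookup edges a) ∈ descLists N (K + m)
  edge-∈ a = ∈-cartesianProduct⁻ (varWords (allFin k) n) (descLists N (K + m)) (∈-lookup {xs = edges} a)

  labels : Fin (length edges) → List ℕ
  labels a = proj₂ (List.lookup edges a)

  base : Fin (length edges) → Fin k → Point k n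
  base a i = subst-var i (proj₁ (List.lookup edges a))

  window : Fin (length edges) → Fin k → List ℕ
  window a i = take m (drop (toℕ i) (labels a))

  base-line : ∀ a → WeakLine (base a)
  base-line a = weakLine-varWord (proj₁ (List.lookup edges a))

  base-inj : ∀ a → Distinct (base a)
  base-inj a = varWord-distinct (proj₁ (∈-varWords⁻ {as = allFin k} (proj₁ (edge-∈ a))))

  window-desc : ∀ D → Desc N D × length D ≡ K + m → (i : Fin k) →
    Desc N (take m (drop (toℕ i) D)) × length (take m (drop (toℕ i) D)) ≡ m
  window-desc D (D↓ , len) i = desc-take m (drop (toℕ i) D) (desc-drop (toℕ i) D D↓) ,
    length-window D len (≤-pred (toℕ<n i))

  _≟L_ : DecidableEquality (List ℕ)
  _≟L_ = Listₚ.≡-dec _≟_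

  typ′ : Fin (length edges) → Fin k → Point k n × List ℕ
  typ′ = typ _≟L_ base window base-line base-inj

  types : List (Point k n × List ℕ)
  types = List.cartesianProductWith typ′ (allFin (length edges)) (allFin k)

  module _ (colour₀ : Fin r) (Π : RamseyPicture _≟L_ base window base-line base-inj r colour₀ types) where
    open RamseyPicture Π

    _≟P_ : DecidableEquality (Point k dim)
    _≟P_ = Vecₚ.≡-dec Fin._≟_

    X : FinSet k dim
    X = deduplicate _≟P_ (map proj₂ picture)

    X-ramsey : RamseyForLines r X
    -- Each `v` gets the table of colours of all types `(v , s)`. Along the resulting line the
    -- colour of a type depends on its tuple `s` alone, and `W` then supplies `D` for the table at
    -- letter `zero`.
    X-ramsey c = find (proj₂ hj (λ v → tableColour (descLists N m) (λ s → colour (v , s))))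
      where
      open Copy (copies (c ∘ proj₂))
      find : MonoLine (allFin k) (allFin k) (λ v → tableColour (descLists N m) (λ s → colour (v , s))) →
        Σ (Fin k → Point k dim) λ η → IsCombinatorialLine η × (∀ i → η i ∈ X) × (∀ i j → c (η i) ≡ c (η j))
      find (w , w-var , w-let , w-mono) with proj₂ (W) (λ s → colour (subst-var zero w , s))
      ... | D , D↓ , len , γ , w-win = φ a , weakLine⇒combinatorialLine (line a) (inj a) ,
          (λ i → ∈-deduplicate⁺ _≟P_ (∈-map⁺ proj₂ (φ∈ a i))) , λ i j → trans (to-γ i) (sym (to-γ j))
        where
        wD∈ : (w , D) ∈ edges
        wD∈ = ∈-cartesianProduct⁺ (∈-varWords⁺ w-var w-let) (∈-descLists⁺ N D D↓ len)
        a = Any.index wD∈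
        typ-a : ∀ i → typ′ a i ≡ (subst-var i w , take m (drop (toℕ i) D))
        typ-a i = cong (λ e → subst-var i (proj₁ e) , take m (drop (toℕ i) (proj₂ e))) (sym (lookup-index wD∈))
        to-γ : ∀ i → c (φ a i) ≡ γ
        to-γ i = begin
          c (φ a i)                                          ≡⟨ mono a i (∈-cartesianProductWith⁺ typ′ (∈-allFin a) (∈-allFin i)) ⟩
          colour (typ′ a i)                                  ≡⟨ cong colour (typ-a i) ⟩
          colour (subst-var i w , take m (drop (toℕ i) D))   ≡⟨ tableColour-≡ (descLists N m) (λ s → colour (subst-var i w , s)) (λ s → colour (subst-var zero w , s))
                                                                  (w-mono (∈-allFin i) (∈-allFin zero))
                                                                  (let W↓ , lenW = window-desc D (D↓ , len) i in ∈-descLists⁺ N _ W↓ lenW) ⟩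
          colour (subst-var zero w , take m (drop (toℕ i) D)) ≡⟨ w-win (toℕ i) (≤-pred (toℕ<n i)) ⟩
          γ                                                  ∎
          where open ≡-Reasoning

    label : Point k dim → Point k n × List ℕ
    label = firstLabel _≟P_ (Vec.replicate n zero , []) picture

    label-∈ : ∀ {y} → y ∈ X → (label y , y) ∈ picture
    label-∈ y∈ = firstLabel-∈ _≟P_ _ picture _ (∈-deduplicate⁻ _≟P_ (map proj₂ picture) y∈)

    label-window : ∀ {y} → y ∈ X → Desc N (proj₂ (label y)) × length (proj₂ (label y)) ≡ m
    label-window {y} y∈ with typed (label-∈ y∈)
    ... | a , i , eq = subst (λ W → Desc N W × length W ≡ m) (sym (cong proj₂ eq))
      (window-desc (labels a) (∈-descLists⁻ N (K + m) (proj₂ (edge-∈ a))) i)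

    module _ (Q : ℕ) where
      open Averaging K Q (proj₂ ∘ label)
      open Marker K

      -- By coherence a quasiline would carry all `k` windows of one decreasing tuple, and one of
      -- these fails the test for every marking `g`.
      survivors-quasilineFree : ∀ g Y → Y ⊆ₛ X → QuasilineFree (survivors g Y)
      survivors-quasilineFree g Y Y⊆X (ℓ , (ℓ-inj , ℓ-quasi) , ℓ∈) with coherent y y∈ ℓ-quasi
        where
        y : Fin k → (Point k n × List ℕ) × Point k dim
        y i = label (ℓ i) , ℓ i
        y∈ : ∀ i → y i ∈ picture
        y∈ i = label-∈ (All.lookup Y⊆X (proj₁ (∈-filter⁻ (λ y → accepts g y Bool.≟ true) {xs = Y} (ℓ∈ i))))
      ... | inj₁ cst with () ← ℓ-inj zero (suc zero) (cong proj₂ (cst zero (suc zero)))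
      ... | inj₂ (a , ρ , ρ-inj , e) with some-rejected (map g (labels a)) m
      -- The permutation `ρ` reaches the rejected window, so some point of the quasiline has it.
      ...   | i₀ , i₀≤K , rejected with injective⇒surjective ρ-inj (fromℕ< (s≤s i₀≤K))
      ...     | i , ρi≡ = contradiction (trans (sym rejected) isAccepted) λ ()
        where
        isAccepted : accept 0 (take m (drop i₀ (map g (labels a)))) ≡ true
        isAccepted = begin
          accept 0 (take m (drop i₀ (map g (labels a))))    ≡⟨ cong (λ l → accept 0 (take m l)) (drop-map i₀ (labels a)) ⟩
          accept 0 (take m (map g (drop i₀ (labels a))))    ≡⟨ cong (accept 0) (take-map m (drop i₀ (labels a))) ⟩
          accept 0 (map g (take m (drop i₀ (labels a))))    ≡⟨ cong (λ j → accept 0 (map g (take m (drop j (labels a))))) (trans (cong toℕ ρi≡) (toℕ-fromℕ< (s≤s i₀≤K))) ⟨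
          accept 0 (map g (window a (ρ i)))                 ≡⟨ cong (λ t → accept 0 (map g (proj₂ t))) (e i) ⟨
          accepts g (ℓ i)                                   ≡⟨ proj₂ (∈-filter⁻ (λ y → accepts g y Bool.≟ true) {xs = Y} (ℓ∈ i)) ⟩
          true ∎
          where open ≡-Reasoning

      X-dense : .{{_ : NonZero Q}} → ∀ p q → p * suc K < q * K → suc Q ≡ 2 * (q * K) → Q * Q ≤ m → DenseQuasilineFree p q X
      X-dense p q gap R≡ Q²≤m Y Y! Y⊆X with many-survivors N p q m gap R≡ Q²≤m Y (λ y∈ → label-window (All.lookup Y⊆X y∈))
      ... | g , large = survivors g Y , Uniqueₚ.filter⁺ _ Y! ,
        All.tabulate (λ z∈ → proj₁ (∈-filter⁻ (λ y → accepts g y Bool.≟ true) {xs = Y} z∈)) ,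
        large , survivors-quasilineFree g Y Y⊆X

    conclusion : ∀ Q .{{_ : NonZero Q}} p q → p * suc K < q * K → suc Q ≡ 2 * (q * K) → Q * Q ≤ m → Conclusion k r p q
    conclusion Q p q gap R≡ Q²≤m = dim , X , deduplicate-! _≟P_ (map proj₂ picture) , X-ramsey , X-dense Q p q gap R≡ Q²≤m

  from-picture : Fin r → ∀ Q .{{_ : NonZero Q}} p q → p * suc K < q * K → suc Q ≡ 2 * (q * K) → Q * Q ≤ m → Conclusion k r p q
  from-picture colour₀ = conclusion colour₀ (partite-construction _≟L_ base window base-line base-inj r colour₀ types)

from-windows : ∀ k′ r m → Windows m (2 + k′) r → Fin r → ∀ Q .{{_ : NonZero Q}} p q →
  p * (3 + k′) < q * (2 + k′) → suc Q ≡ 2 * (q * (2 + k′)) → Q * Q ≤ m → Conclusion (3 + k′) r p q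
from-windows k′ r m W = Construction.from-picture k′ r m W
  (hales-jewett (allFin (3 + k′)) (allFin (3 + k′)) (λ x → x) (r ^ length (descLists (proj₁ W) m)))

-- A real `μ` is covered by any rational `p / q` between `μ` and `(k - 1) / k`.
theorem1p7 : (k r p q : ℕ) → 3 ≤ k → 1 ≤ r → 0 < p → p * k < q * (k ∸ 1) →
    Σ ℕ λ n → Σ (FinSet k n) λ X →
    IsSet X × RamseyForLines r X × DenseQuasilineFree p q X
theorem1p7 (suc (suc (suc k′))) (suc r) p q _ _ _ gap = result (q * (2 + k′)) refl
  where
  double : ∀ x → suc (suc (x + x)) ≡ 2 * suc x
  double = solve-∀
  result : ∀ g → g ≡ q * (2 + k′) → Conclusion (3 + k′) (suc r) p q
  result zero eq with () ← subst (p * (3 + k′) <_) (sym eq) gap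
  -- With `q * (k - 1) = suc x` this `Q` gives `R = 2 * (q * (k - 1))`. The window length is at
  -- least `Q * Q`, to make unmarked windows rare, and the 2 is added because `windows` starts at
  -- length 2.
  result (suc x) eq = from-windows k′ (suc r) (2 + Q * Q) (windows (Q * Q) (2 + k′) (suc r)) zero Q p q gap
    (trans (double x) (cong (2 *_) eq)) (m≤n+m (Q * Q) 2)
    where Q = suc (x + x)
theorem1p7 (suc (suc zero)) _ _ _ (s≤s (s≤s ()))
theorem1p7 (suc zero) _ _ _ (s≤s ())
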